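{- Let $\Gamma$ be a distance-regular graph with intersection array $\{80,54,12;1,6,60\}$. Let $x$ be a vertex of $\Gamma$ and let $\Delta:=\Delta(x)$ be the local graph at $x$. Then $\Delta$ contains $4$ (pairwise) disjoint cliques with $20$ vertices each.
   Context: All graphs are finite, undirected and simple. A connected graph $\Gamma$ of diameter $D$ is distance-regular with intersection array $\{b_0,\ldots,b_{D-1};c_1,\ldots,c_D\}$ if for every $i\in\{0,\ldots,D\}$ and every pair of vertices $x,y$ at distance $i$, the number of neighbors of $y$ at distance $i-1$ from $x$ equals $c_i$ and the number of neighbors of $y$ at distance $i+1$ from $x$ equals $b_i$ (with $c_0=b_D=0$). The local graph $\Delta(x)$ at a vertex $x$ is the subgraph of $\Gamma$ induced on the neighbors of $x$ (here it has $80$ vertices). A clique is a set of pairwise adjacent vertices. -}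

module Defs where

open import Data.Fin using (Fin; toℕ)
open import Data.Fin.Subset using (Subset; _∈_; ∣_∣)
open import Data.List using (List; allFin; filter; length) renaming (lookup to lookupˡ)
open import Data.Nat using (ℕ; zero; suc; _≤_)
open import Data.Product using (∃; ∃₂; _×_)
open import Data.Vec using (Vec; _∷_; _∷ʳ_; lookup)
open import Function.Bundles using (_⇔_)
open import Level using (0ℓ)
open import Relation.Binary.Core using (Rel)
open import Relation.Binary.Definitions using (Decidable; Irreflexive; Symmetric)
open import Relation.Binary.PropositionalEquality using (_≡_; _≢_; refl)
import Relation.Unary as U

record Graph : Set₁ where
  field
    order    : ℕ
    Adj      : Rel (Fin order) 0ℓ
    adj?     : Decidable Adj
    adj-sym  : Symmetric Adj
    adj-irr  : Irreflexive _≡_ Adj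

  Vertex : Set
  Vertex = Fin order

open Graph public using (order; Vertex)

-- The subgraph induced on the vertices satisfying P.  Its vertex k stands for
-- the k-th vertex of Γ, in increasing order, that satisfies P; the list of
-- these has no repetitions because allFin has none.
induced : (Γ : Graph) {P : U.Pred (Vertex Γ) 0ℓ} → U.Decidable P → Graph
induced Γ P? = record
  { order   = length vs
  ; Adj     = λ i j → Adj (lookupˡ vs i) (lookupˡ vs j)
  ; adj?    = λ i j → adj? (lookupˡ vs i) (lookupˡ vs j)
  ; adj-sym = adj-sym
  ; adj-irr = λ { refl → adj-irr refl }
  }
  where
  open Graph Γ using (Adj; adj?; adj-sym; adj-irr)
  vs : List (Vertex Γ)
  vs = filter P? (allFin (order Γ))

localGraph : (Γ : Graph) → Vertex Γ → Graph
localGraph Γ x = induced Γ (Graph.adj? Γ x)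

IsClique : (Γ : Graph) → Subset (order Γ) → Set
IsClique Γ C = ∀ {u v} → u ∈ C → v ∈ C → u ≢ v → Graph.Adj Γ u v

HasSize : ∀ {n} → U.Pred (Fin n) 0ℓ → ℕ → Set
HasSize {n} P k = ∃ λ (S : Subset n) → (∀ z → (z ∈ S) ⇔ P z) × ∣ S ∣ ≡ k

module _ (Γ : Graph) where
  open Graph Γ using (Adj)

  data Walk : Vertex Γ → Vertex Γ → ℕ → Set where
    []  : ∀ {x} → Walk x x zero
    _∷_ : ∀ {x y z k} → Adj x y → Walk y z k → Walk x z (suc k)

  Distance : Vertex Γ → Vertex Γ → ℕ → Set
  Distance x y d = Walk x y d × (∀ {k} → Walk x y k → d ≤ k)

  Connected : Set
  Connected = ∀ x y → ∃ λ k → Walk x y k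

  Diameter : ℕ → Set
  Diameter D = (∀ {x y d} → Distance x y d → d ≤ D) × (∃₂ λ x y → Distance x y D)

  -- "At distance i - 1" is written as distance j with suc j ≡ i, so that no
  -- vertex qualifies when i is zero.
  NeighboursBelow : (x y : Vertex Γ) → ℕ → U.Pred (Vertex Γ) 0ℓ
  NeighboursBelow x y i z = Adj y z × (∃ λ j → suc j ≡ i × Distance x z j)

  NeighboursAbove : (x y : Vertex Γ) → ℕ → U.Pred (Vertex Γ) 0ℓ
  NeighboursAbove x y i z = Adj y z × Distance x z (suc i)

  -- bs = (b₀, …, b_{D-1}) and cs = (c₁, …, c_D); extending them by b_D = 0 and
  -- c₀ = 0 lets both be indexed by i ∈ {0, …, D}.
  record IsDistanceRegular {D : ℕ} (bs cs : Vec ℕ D) : Set where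
    field
      connected : Connected
      diameter  : Diameter D
      c-count   : ∀ (i : Fin (suc D)) {x y} → Distance x y (toℕ i) →
                  HasSize (NeighboursBelow x y (toℕ i)) (lookup (0 ∷ cs) i)
      b-count   : ∀ (i : Fin (suc D)) {x y} → Distance x y (toℕ i) →
                  HasSize (NeighboursAbove x y (toℕ i)) (lookup (bs ∷ʳ 0) i)

{-# OPTIONS --safe #-}

-- Write Δ for the local graph.  It has 80 vertices and valency 25, two non-adjacent vertices
-- have at most c₂ - 1 = 5 common neighbours in Δ, and by Delsarte's bound for the eigenvalue
-- -4 of Γ a clique of Δ has at most 20 vertices.  The rest is counting in Δ.
--
-- Δ has no 5-coclique.  Inclusion-exclusion for closed neighbourhoods is tight on a 5-coclique
-- a, b, c, d, e: every vertex has one or two neighbours in it and every two members have exactly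
-- 5 common neighbours.  A common neighbour m of a and b lies itself in a 5-coclique with c, d, e
-- (otherwise large cliques around m give m and c too many common neighbours), so m has exactly
-- 5 neighbours adjacent to c, each of them adjacent to exactly one of a and b.  Hence, among the
-- three sets of 5 common neighbours of a, b, of a, c and of b, c, the numbers of edges between
-- two of them add up in pairs to 25, which is impossible for parity reasons.
--
-- So every vertex has a neighbour in a given 4-coclique a, b, c, d.  The vertices seen by a only
-- form a clique with at least 11 members, and the vertices adjacent to all of them form a larger
-- clique, the cluster of a.  A vertex with at most two neighbours in the coclique lies in a
-- cluster, since otherwise there is a pentagon in the complement.  At most 6 vertices have more
-- neighbours, and counting the neighbours of an unclustered one shows that it cannot exist.
-- Thus four cliques of at most 20 vertices cover the 80 vertices of Δ.

module Submission where

open import Defs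
import Data.Nat.Properties as ℕ
open import Algebra.Properties.Semiring.Sum ℕ.+-*-semiring
  using (sum; sum-cong-≗; ∑-distrib-+; ∑-comm; *-distribˡ-sum; *-distribʳ-sum)
open import Data.Bool using (Bool; true; false; T; _∧_; _∨_; not)
import Data.Bool.Properties as Bool
open import Data.Empty using (⊥; ⊥-elim)
open import Data.Fin using (Fin; zero; suc; toℕ; fromℕ<)
open import Data.Fin.Patterns using (0F; 1F; 2F; 3F)
open import Data.Fin.Properties using (any?; all?; toℕ-injective; toℕ-fromℕ<) renaming (_≟_ to _≟ᶠ_)
open import Data.Fin.Subset using (Subset; inside; outside; _∈_; ∣_∣; _∩_; Empty)
open import Data.Fin.Subset.Properties using (x∈p∩q⁻)
open import Data.List as List using (List; []; _∷_; allFin; filter)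
open import Data.List.Membership.Propositional.Properties using (∈-lookup; ∈-filter⁻)
open import Data.List.Relation.Unary.All as All using (All; []; _∷_)
open import Data.List.Relation.Unary.AllPairs using (AllPairs; []; _∷_; tail)
open import Data.List.Relation.Unary.Unique.Propositional using (Unique)
open import Data.List.Relation.Unary.Unique.Propositional.Properties using (allFin⁺; filter⁺)
open import Data.Nat
import Data.Nat.ListAction as ListAction
open import Data.Nat.Properties
open import Data.Nat.Tactic.RingSolver using (solve-∀)
open import Data.Product using (∃; _×_; _,_; proj₁; proj₂)
open import Data.Sum using (_⊎_; inj₁; inj₂)
open import Data.Vec as Vec using (Vec; []; _∷_)
open import Data.Vec.Properties using ([]=⇒lookup; lookup⇒[]=; lookup∘tabulate)
open import Function using (_∘_; _$_)
open import Function.Bundles using (Equivalence)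
open import Relation.Binary.PropositionalEquality
open import Relation.Nullary using (Dec; yes; no; ¬_; does; _×-dec_)
open import Relation.Nullary.Decidable using (dec-false; dec-true; toWitness; map′)
open import Relation.Unary using (Decidable)

private variable
  n k : ℕ

-- Counting by truth tables

⟦_⟧ : Bool → ℕ
⟦ true ⟧  = 1
⟦ false ⟧ = 0

# : (Fin n → Bool) → ℕ
# p = sum (λ v → ⟦ p v ⟧)

sum-mono-≤ : (f g : Fin n → ℕ) → (∀ v → f v ≤ g v) → sum f ≤ sum g
sum-mono-≤ {zero}  f g f≤g = z≤n
sum-mono-≤ {suc n} f g f≤g = +-mono-≤ (f≤g zero) (sum-mono-≤ (f ∘ suc) (g ∘ suc) (f≤g ∘ suc))

sum-const : ∀ n c → sum {n} (λ _ → c) ≡ n * c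
sum-const zero    c = refl
sum-const (suc n) c = cong (c +_) (sum-const n c)

sum-tight : (f g : Fin n → ℕ) → (∀ v → f v ≤ g v) → sum g ≤ sum f → ∀ v → f v ≡ g v
sum-tight {suc n} f g f≤g Σg≤Σf = λ where
    zero    → ≤-antisym (f≤g zero) (+-cancelʳ-≤ _ _ _ (≤-trans Σg≤Σf (+-monoʳ-≤ (f zero) rest)))
    (suc v) → sum-tight (f ∘ suc) (g ∘ suc) (f≤g ∘ suc)
                (+-cancelˡ-≤ _ _ _ (≤-trans Σg≤Σf (+-monoˡ-≤ _ (f≤g zero)))) v
  where
  rest : sum (f ∘ suc) ≤ sum (g ∘ suc)
  rest = sum-mono-≤ (f ∘ suc) (g ∘ suc) (f≤g ∘ suc)

-- Statements about the pattern of memberships of a single vertex in finitely many sets are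
-- Boolean formulas, checked on all patterns by evaluation.  Likewise a linear inequality between
-- cardinalities of Boolean combinations of sets is checked at a single vertex and then summed.
Formula : ℕ → Set
Formula zero    = Bool
Formula (suc k) = Bool → Formula k

infix 10 _⟨_⟩
_⟨_⟩ : Formula k → Vec Bool k → Bool
φ ⟨ [] ⟩     = φ
φ ⟨ b ∷ bs ⟩ = φ b ⟨ bs ⟩

infixr 3 _⇒_
_⇒_ : Bool → Bool → Bool
b ⇒ c = not b ∨ c

⋀ : List (Formula k) → Vec Bool k → Bool
⋀ hs bs = List.foldr (λ h → h ⟨ bs ⟩ ∧_) true hs

weight : List (Formula k) → Vec Bool k → ℕ
weight φs bs = List.foldr (λ φ → ⟦ φ ⟨ bs ⟩ ⟧ +_) 0 φs

valid : ∀ k → (Vec Bool k → Bool) → Bool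
valid zero    f = f []
valid (suc k) f = valid k (f ∘ (true ∷_)) ∧ valid k (f ∘ (false ∷_))

∧-trueˡ : ∀ {b c} → b ∧ c ≡ true → b ≡ true
∧-trueˡ {true} _ = refl

∧-trueʳ : ∀ {b c} → b ∧ c ≡ true → c ≡ true
∧-trueʳ {true} p = p

∧-true : ∀ {b c} → b ≡ true → c ≡ true → b ∧ c ≡ true
∧-true refl refl = refl

valid-sound : (f : Vec Bool k → Bool) → valid k f ≡ true → ∀ bs → f bs ≡ true
valid-sound f ok []           = ok
valid-sound f ok (true  ∷ bs) = valid-sound (f ∘ (true ∷_)) (∧-trueˡ ok) bs
valid-sound {suc k} f ok (false ∷ bs) =
  valid-sound (f ∘ (false ∷_)) (∧-trueʳ {valid k (f ∘ (true ∷_))} ok) bs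

Holds : Vec Bool k → List (Formula k) → Set
Holds bs = All (λ h → h ⟨ bs ⟩ ≡ true)

⋀-true : ∀ (bs : Vec Bool k) {hs} → Holds bs hs → ⋀ hs bs ≡ true
⋀-true bs []       = refl
⋀-true bs (p ∷ ps) = ∧-true p (⋀-true bs ps)

⇒-elim : ∀ {b c} → (b ⇒ c) ≡ true → b ≡ true → c ≡ true
⇒-elim {true} p _ = p

⇒-intro : ∀ {b c} → (b ≡ true → c ≡ true) → (b ⇒ c) ≡ true
⇒-intro {true}  f = f refl
⇒-intro {false} f = refl

entails : (hs : List (Formula k)) (φ : Formula k) →
          valid k (λ bs → ⋀ hs bs ⇒ φ ⟨ bs ⟩) ≡ true →
          ∀ bs → Holds bs hs → φ ⟨ bs ⟩ ≡ true
entails hs φ ok bs ps = ⇒-elim (valid-sound _ ok bs) (⋀-true bs ps)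

≤ᵇ-true : ∀ {l r} → (l ≤ᵇ r) ≡ true → l ≤ r
≤ᵇ-true {l} {r} p = ≤ᵇ⇒≤ l r (subst T (sym p) _)

≡ᵇ-true : ∀ {l r} → (l ≡ᵇ r) ≡ true → l ≡ r
≡ᵇ-true {l} {r} p = ≡ᵇ⇒≡ l r (subst T (sym p) _)

≡⇒≡ᵇ-true : ∀ {l r} → l ≡ r → (l ≡ᵇ r) ≡ true
≡⇒≡ᵇ-true {zero}  refl = refl
≡⇒≡ᵇ-true {suc l} refl = ≡⇒≡ᵇ-true {l} refl

at : Vec (Fin n → Bool) k → Fin n → Vec Bool k
at ps v = Vec.map (_$ v) ps

-- The fold computes to a sum ending in `+ 0`; this is the shape that the arithmetic helpers
-- `counts` below have to match.
total : List (Formula k) → Vec (Fin n → Bool) k → ℕ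
total φs ps = List.foldr (λ φ → # (λ v → φ ⟨ at ps v ⟩) +_) 0 φs

total≡sum-weight : (φs : List (Formula k)) (ps : Vec (Fin n → Bool) k) →
                   total φs ps ≡ sum (λ v → weight φs (at ps v))
total≡sum-weight {n = n} [] ps = sym (trans (sum-const n 0) (*-zeroʳ n))
total≡sum-weight (φ ∷ φs) ps =
  trans (cong (# (λ v → φ ⟨ at ps v ⟩) +_) (total≡sum-weight φs ps))
        (sym (∑-distrib-+ (λ v → ⟦ φ ⟨ at ps v ⟩ ⟧) (λ v → weight φs (at ps v))))

module _ (hs ls rs : List (Formula k)) (ps : Vec (Fin n → Bool) k)
         (holds : ∀ v → Holds (at ps v) hs) where

  count-≤ : valid k (λ bs → ⋀ hs bs ⇒ weight ls bs ≤ᵇ weight rs bs) ≡ true →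
            total ls ps ≤ total rs ps
  count-≤ ok = subst₂ _≤_ (sym (total≡sum-weight ls ps)) (sym (total≡sum-weight rs ps))
    (sum-mono-≤ _ _ λ v → ≤ᵇ-true (⇒-elim (valid-sound _ ok (at ps v)) (⋀-true (at ps v) (holds v))))

  count-≡ : valid k (λ bs → ⋀ hs bs ⇒ weight ls bs ≡ᵇ weight rs bs) ≡ true →
            total ls ps ≡ total rs ps
  count-≡ ok = trans (total≡sum-weight ls ps) (trans
    (sum-cong-≗ λ v → ≡ᵇ-true (⇒-elim (valid-sound _ ok (at ps v)) (⋀-true (at ps v) (holds v))))
    (sym (total≡sum-weight rs ps)))

  -- Equality case: if the totals also compare the other way, the pointwise inequality is an
  -- equality at every vertex, and `φ` holds on all patterns where the two weights agree.
  count-tight : (φ : Formula k) →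
                valid k (λ bs → ⋀ hs bs ⇒ weight ls bs ≤ᵇ weight rs bs) ≡ true →
                valid k (λ bs → ⋀ hs bs ∧ (weight ls bs ≡ᵇ weight rs bs) ⇒ φ ⟨ bs ⟩) ≡ true →
                total rs ps ≤ total ls ps → ∀ v → φ ⟨ at ps v ⟩ ≡ true
  count-tight φ ok ok′ r≤l v = ⇒-elim (valid-sound _ ok′ (at ps v))
    (∧-true (⋀-true (at ps v) (holds v)) (≡⇒≡ᵇ-true (sum-tight _ _
      (λ u → ≤ᵇ-true (⇒-elim (valid-sound _ ok (at ps u)) (⋀-true (at ps u) (holds u))))
      (subst₂ _≤_ (total≡sum-weight rs ps) (total≡sum-weight ls ps) r≤l) v)))

#-⊤ : # {n} (λ _ → true) ≡ n
#-⊤ {n} = trans (sum-const n 1) (*-identityʳ n)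

#-mono : {p q : Fin n → Bool} → (∀ v → p v ≡ true → q v ≡ true) → # p ≤ # q
#-mono {p = p} {q} p⇒q = sum-mono-≤ _ _ λ v → go (p v) (q v) (p⇒q v)
  where
  go : ∀ b c → (b ≡ true → c ≡ true) → ⟦ b ⟧ ≤ ⟦ c ⟧
  go false c     _ = z≤n
  go true  true  _ = ≤-refl
  go true  false f with () ← f refl

dichotomy : ∀ b → b ≡ true ⊎ not b ≡ true
dichotomy true  = inj₁ refl
dichotomy false = inj₂ refl

search : (p : Fin n → Bool) → (∃ λ v → p v ≡ true) ⊎ (∀ v → not (p v) ≡ true)
search p with any? (λ v → p v Bool.≟ true)
... | yes found = inj₁ found
... | no ¬found = inj₂ λ v → cong not (Bool.¬-not (λ pv → ¬found (v , pv)))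

contradictory : ∀ {b} {A : Set} → b ≡ true → not b ≡ true → A
contradictory refl ()

#-witness : (p q : Fin n → Bool) → # q < # p → ∃ λ v → p v ≡ true × not (q v) ≡ true
#-witness p q q<p with search (λ v → p v ∧ not (q v))
... | inj₁ (v , pq) = v , ∧-trueˡ pq , ∧-trueʳ {p v} pq
... | inj₂ none = ⊥-elim (<⇒≱ q<p (#-mono λ v pv →
        entails ((λ a b → not (a ∧ not b)) ∷ (λ a b → a) ∷ []) (λ a b → b) refl
                (p v ∷ q v ∷ []) (none v ∷ pv ∷ [])))

all-tight : ∀ {m} (xs : List ℕ) → All (_≤ m) xs → List.length xs * m ≤ ListAction.sum xs → All (_≡ m) xs
all-tight []       []       _ = []
all-tight {m} (x ∷ xs) (x≤m ∷ xs≤m) lower =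
  ≤-antisym x≤m (+-cancelʳ-≤ (List.length xs * m) m x (≤-trans lower (+-monoʳ-≤ x (bound xs xs≤m)))) ∷
  all-tight xs xs≤m (+-cancelˡ-≤ m _ _ (≤-trans lower (+-monoˡ-≤ (ListAction.sum xs) x≤m)))
  where
  bound : ∀ ys → All (_≤ m) ys → ListAction.sum ys ≤ List.length ys * m
  bound []       []            = z≤n
  bound (y ∷ ys) (y≤m ∷ ys≤m) = +-mono-≤ y≤m (bound ys ys≤m)

#-empty : (p : Fin n → Bool) → (∀ v → not (p v) ≡ true) → # p ≡ 0
#-empty {n} p none = trans (sum-cong-≗ {n} (λ v → go (p v) (none v))) (trans (sum-const n 0) (*-zeroʳ n))
  where
  go : ∀ b → not b ≡ true → ⟦ b ⟧ ≡ 0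
  go false _ = refl

-- Double counting and quadratic forms

double-sum : (p q : Fin n → Bool) (r : Fin n → Fin n → Bool) →
  sum (λ u → ⟦ p u ⟧ * # (λ v → r u v ∧ q v)) ≡ sum (λ v → ⟦ q v ⟧ * # (λ u → r u v ∧ p u))
double-sum p q r = begin
  sum (λ u → ⟦ p u ⟧ * # (λ v → r u v ∧ q v))           ≡⟨ sum-cong-≗ (λ u → *-distribˡ-sum ⟦ p u ⟧ (λ v → ⟦ r u v ∧ q v ⟧)) ⟩
  sum (λ u → sum (λ v → ⟦ p u ⟧ * ⟦ r u v ∧ q v ⟧))     ≡⟨ ∑-comm (λ u v → ⟦ p u ⟧ * ⟦ r u v ∧ q v ⟧) ⟩
  sum (λ v → sum (λ u → ⟦ p u ⟧ * ⟦ r u v ∧ q v ⟧))     ≡⟨ sum-cong-≗ (λ v → sum-cong-≗ (λ u → swap (p u) (q v) (r u v))) ⟩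
  sum (λ v → sum (λ u → ⟦ q v ⟧ * ⟦ r u v ∧ p u ⟧))     ≡⟨ sum-cong-≗ (λ v → *-distribˡ-sum ⟦ q v ⟧ (λ u → ⟦ r u v ∧ p u ⟧)) ⟨
  sum (λ v → ⟦ q v ⟧ * # (λ u → r u v ∧ p u))           ∎
  where
  open ≡-Reasoning
  swap : ∀ b c x → ⟦ b ⟧ * ⟦ x ∧ c ⟧ ≡ ⟦ c ⟧ * ⟦ x ∧ b ⟧
  swap true  true  x = refl
  swap true  false x rewrite Bool.∧-zeroʳ x = refl
  swap false true  x rewrite Bool.∧-zeroʳ x = refl
  swap false false x = refl

double-count : (p q : Fin n → Bool) (r : Fin n → Fin n → Bool) {a b : ℕ} →
  (∀ u → p u ≡ true → # (λ v → r u v ∧ q v) ≡ a) → (∀ v → q v ≡ true → # (λ u → r u v ∧ p u) ≡ b) →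
  # p * a ≡ # q * b
double-count p q r {a} {b} rows columns = begin
  # p * a                                         ≡⟨ *-distribʳ-sum a (λ u → ⟦ p u ⟧) ⟩
  sum (λ u → ⟦ p u ⟧ * a)                         ≡⟨ sum-cong-≗ (λ u → weigh (p u) (rows u)) ⟨
  sum (λ u → ⟦ p u ⟧ * # (λ v → r u v ∧ q v))     ≡⟨ double-sum p q r ⟩
  sum (λ v → ⟦ q v ⟧ * # (λ u → r u v ∧ p u))     ≡⟨ sum-cong-≗ (λ v → weigh (q v) (columns v)) ⟩
  sum (λ v → ⟦ q v ⟧ * b)                         ≡⟨ *-distribʳ-sum b (λ v → ⟦ q v ⟧) ⟨
  # q * b                                         ∎
  where
  open ≡-Reasoning
  weigh : ∀ c {k l} → (c ≡ true → k ≡ l) → ⟦ c ⟧ * k ≡ ⟦ c ⟧ * l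
  weigh true  f = cong (1 *_) (f refl)
  weigh false f = refl

sum-delta : ∀ {m} (g : Fin m → ℕ) (c : Fin m) → sum (λ i → g i * ⟦ does (c ≟ᶠ i) ⟧) ≡ g c
sum-delta {suc m} g zero    = trans (cong₂ _+_ (*-identityʳ (g zero))
  (trans (sum-cong-≗ λ i → *-zeroʳ (g (suc i))) (trans (sum-const m 0) (*-zeroʳ m)))) (+-identityʳ (g zero))
sum-delta {suc m} g (suc c) = cong₂ _+_ (*-zeroʳ (g zero)) (sum-delta (g ∘ suc) c)

-- Linear combinations of indicators; the rows of a product of distance matrices are written in this
-- form.
combination : List ((Fin n → Bool) × ℕ) → Fin n → ℕ
combination qs v = List.foldr (λ (q , c) → ⟦ q v ⟧ * c +_) 0 qs

sum-combination : (p : Fin n → Bool) (qs : List ((Fin n → Bool) × ℕ)) →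
  sum (λ v → ⟦ p v ⟧ * combination qs v) ≡ List.foldr (λ (q , c) → # (λ v → p v ∧ q v) * c +_) 0 qs
sum-combination {n} p [] = trans (sum-cong-≗ λ v → *-zeroʳ ⟦ p v ⟧) (trans (sum-const n 0) (*-zeroʳ n))
sum-combination p ((q , c) ∷ qs) = begin
  sum (λ v → ⟦ p v ⟧ * (⟦ q v ⟧ * c + combination qs v))                      ≡⟨ sum-cong-≗ (λ v → trans (*-distribˡ-+ ⟦ p v ⟧ _ _) (cong (_+ ⟦ p v ⟧ * combination qs v) (merge (p v) (q v)))) ⟩
  sum (λ v → ⟦ p v ∧ q v ⟧ * c + ⟦ p v ⟧ * combination qs v)                  ≡⟨ ∑-distrib-+ (λ v → ⟦ p v ∧ q v ⟧ * c) (λ v → ⟦ p v ⟧ * combination qs v) ⟩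
  sum (λ v → ⟦ p v ∧ q v ⟧ * c) + sum (λ v → ⟦ p v ⟧ * combination qs v)      ≡⟨ cong₂ _+_ (sym (*-distribʳ-sum c (λ v → ⟦ p v ∧ q v ⟧))) (sum-combination p qs) ⟩
  # (λ v → p v ∧ q v) * c + List.foldr (λ (q , c) → # (λ v → p v ∧ q v) * c +_) 0 qs ∎
  where
  open ≡-Reasoning
  merge : ∀ a b → ⟦ a ⟧ * (⟦ b ⟧ * c) ≡ ⟦ a ∧ b ⟧ * c
  merge true  b = *-identityˡ (⟦ b ⟧ * c)
  merge false b = refl

-- The diagonal correction O * # f is on the left to avoid subtraction.
gram : ∀ {m} (f : Fin m → Bool) (M : Fin m → Fin m → ℕ) (D O : ℕ) →
  (∀ i → f i ≡ true → M i i ≡ D) → (∀ i j → f i ≡ true → f j ≡ true → i ≢ j → M i j ≡ O) →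
  sum (λ i → sum (λ j → ⟦ f i ⟧ * ⟦ f j ⟧ * M i j)) + O * # f ≡ D * # f + O * (# f * # f)
gram {m} f M D O diagonal off-diagonal = begin
  sum (λ i → sum (λ j → ⟦ f i ⟧ * ⟦ f j ⟧ * M i j)) + O * # f
    ≡⟨ cong (sum (λ i → sum (λ j → ⟦ f i ⟧ * ⟦ f j ⟧ * M i j)) +_) (*-distribˡ-sum O (λ i → ⟦ f i ⟧)) ⟩
  sum (λ i → sum (λ j → ⟦ f i ⟧ * ⟦ f j ⟧ * M i j)) + sum (λ i → O * ⟦ f i ⟧)
    ≡⟨ ∑-distrib-+ (λ i → sum (λ j → ⟦ f i ⟧ * ⟦ f j ⟧ * M i j)) (λ i → O * ⟦ f i ⟧) ⟨
  sum (λ i → sum (λ j → ⟦ f i ⟧ * ⟦ f j ⟧ * M i j) + O * ⟦ f i ⟧)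
    ≡⟨ sum-cong-≗ row ⟩
  sum (λ i → D * ⟦ f i ⟧ + O * ⟦ f i ⟧ * # f)
    ≡⟨ ∑-distrib-+ (λ i → D * ⟦ f i ⟧) (λ i → O * ⟦ f i ⟧ * # f) ⟩
  sum (λ i → D * ⟦ f i ⟧) + sum (λ i → O * ⟦ f i ⟧ * # f)
    ≡⟨ cong₂ _+_ (*-distribˡ-sum D (λ i → ⟦ f i ⟧)) (*-distribʳ-sum (# f) (λ i → O * ⟦ f i ⟧)) ⟨
  D * # f + sum (λ i → O * ⟦ f i ⟧) * # f
    ≡⟨ cong (λ s → D * # f + s * # f) (*-distribˡ-sum O (λ i → ⟦ f i ⟧)) ⟨
  D * # f + O * # f * # f
    ≡⟨ cong (D * # f +_) (*-assoc O (# f) (# f)) ⟩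
  D * # f + O * (# f * # f) ∎
  where
  open ≡-Reasoning
  -- On `f` the matrix is `O` times all-ones plus (`D` - `O`) times the identity; the negative
  -- diagonal term is moved to the left.
  entry : ∀ i j → ⟦ f i ⟧ * ⟦ f j ⟧ * M i j + O * ⟦ f i ⟧ * ⟦ does (i ≟ᶠ j) ⟧ ≡
                  D * ⟦ f i ⟧ * ⟦ does (i ≟ᶠ j) ⟧ + O * ⟦ f i ⟧ * ⟦ f j ⟧
  entry i j = go (f i) (f j) (i ≟ᶠ j) refl refl
    where
    go : ∀ b c (i≟j : Dec (i ≡ j)) → f i ≡ b → f j ≡ c →
         ⟦ b ⟧ * ⟦ c ⟧ * M i j + O * ⟦ b ⟧ * ⟦ does i≟j ⟧ ≡ D * ⟦ b ⟧ * ⟦ does i≟j ⟧ + O * ⟦ b ⟧ * ⟦ c ⟧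
    go false c _ _ _ rewrite *-zeroʳ O | *-zeroʳ D = refl
    go true false (yes refl) fi fj with () ← trans (sym fi) fj
    go true false (no _) _ _ rewrite *-zeroʳ (O * 1) | *-zeroʳ (D * 1) = refl
    go true true (yes refl) fi _ rewrite diagonal i fi | *-identityʳ O | *-identityʳ O | *-identityʳ D | *-identityʳ D | +-identityʳ D = refl
    go true true (no i≢j) fi fj rewrite off-diagonal i j fi fj i≢j | *-zeroʳ (O * 1) | *-zeroʳ (D * 1) | *-identityʳ O | *-identityʳ O | +-identityʳ O | +-identityʳ O = refl
  row : ∀ i → sum (λ j → ⟦ f i ⟧ * ⟦ f j ⟧ * M i j) + O * ⟦ f i ⟧ ≡ D * ⟦ f i ⟧ + O * ⟦ f i ⟧ * # f
  row i = begin
    sum (λ j → ⟦ f i ⟧ * ⟦ f j ⟧ * M i j) + O * ⟦ f i ⟧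
      ≡⟨ cong (sum (λ j → ⟦ f i ⟧ * ⟦ f j ⟧ * M i j) +_) (sum-delta (λ _ → O * ⟦ f i ⟧) i) ⟨
    sum (λ j → ⟦ f i ⟧ * ⟦ f j ⟧ * M i j) + sum (λ j → O * ⟦ f i ⟧ * ⟦ does (i ≟ᶠ j) ⟧)
      ≡⟨ ∑-distrib-+ (λ j → ⟦ f i ⟧ * ⟦ f j ⟧ * M i j) (λ j → O * ⟦ f i ⟧ * ⟦ does (i ≟ᶠ j) ⟧) ⟨
    sum (λ j → ⟦ f i ⟧ * ⟦ f j ⟧ * M i j + O * ⟦ f i ⟧ * ⟦ does (i ≟ᶠ j) ⟧)
      ≡⟨ sum-cong-≗ (entry i) ⟩
    sum (λ j → D * ⟦ f i ⟧ * ⟦ does (i ≟ᶠ j) ⟧ + O * ⟦ f i ⟧ * ⟦ f j ⟧)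
      ≡⟨ ∑-distrib-+ (λ j → D * ⟦ f i ⟧ * ⟦ does (i ≟ᶠ j) ⟧) (λ j → O * ⟦ f i ⟧ * ⟦ f j ⟧) ⟩
    sum (λ j → D * ⟦ f i ⟧ * ⟦ does (i ≟ᶠ j) ⟧) + sum (λ j → O * ⟦ f i ⟧ * ⟦ f j ⟧)
      ≡⟨ cong₂ _+_ (sum-delta (λ _ → D * ⟦ f i ⟧) i) (sym (*-distribˡ-sum (O * ⟦ f i ⟧) (λ j → ⟦ f j ⟧))) ⟩
    D * ⟦ f i ⟧ + O * ⟦ f i ⟧ * # f ∎

none : List Bool → Bool
none = List.foldr (λ b r → not b ∧ r) true

exactly-one at-least-three : Formula 4
exactly-one a b c d    = ⟦ a ⟧ + (⟦ b ⟧ + (⟦ c ⟧ + ⟦ d ⟧)) ≡ᵇ 1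
at-least-three a b c d = 3 ≤ᵇ ⟦ a ⟧ + (⟦ b ⟧ + (⟦ c ⟧ + ⟦ d ⟧))

once-or-twice : Formula 5
once-or-twice a b c d e = let s = ⟦ a ⟧ + (⟦ b ⟧ + (⟦ c ⟧ + (⟦ d ⟧ + ⟦ e ⟧))) in (s ≡ᵇ 1) ∨ (s ≡ᵇ 2)

-- Counting in the local graph

-- Here u ~ v means that u and v are equal or adjacent, so that `degree` and `common` are about
-- closed neighbourhoods and u ≁ v says that u and v are distinct and not adjacent.
module LocalStructure
  {n : ℕ} (_~_ : Fin n → Fin n → Bool)
  (~-sym : ∀ u v → u ~ v ≡ v ~ u)
  (order≡80 : n ≡ 80)
  (degree : ∀ u → # (u ~_) ≡ 26)
  (common : ∀ {u v} → not (u ~ v) ≡ true → # (λ w → u ~ w ∧ v ~ w) ≤ 5)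
  (clique≤20 : ∀ p → (∀ u v → p u ≡ true → p v ≡ true → u ~ v ≡ true) → # p ≤ 20)
  where

  V : Set
  V = Fin n

  infix 4 _≁_
  _≁_ : V → V → Set
  u ≁ v = not (u ~ v) ≡ true

  ≁-sym : ∀ {u v} → u ≁ v → v ≁ u
  ≁-sym {u} {v} p = trans (cong not (~-sym v u)) p

  ~-flip : ∀ {u v} → u ~ v ≡ true → v ~ u ≡ true
  ~-flip {u} {v} p = trans (~-sym v u) p

  #V : # {n} (λ _ → true) ≡ 80
  #V = trans #-⊤ order≡80

  avoid : List V → V → Bool
  avoid cs v = none (List.map (_~ v) cs)

  avoid⇒≁ : ∀ {v} cs → avoid cs v ≡ true → All (_≁ v) cs
  avoid⇒≁ []       _ = []
  avoid⇒≁ {v} (c ∷ cs) p = ∧-trueˡ p ∷ avoid⇒≁ cs (∧-trueʳ {not (c ~ v)} p)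

  ≁⇒avoid : ∀ {v cs} → All (_≁ v) cs → avoid cs v ≡ true
  ≁⇒avoid []       = refl
  ≁⇒avoid (p ∷ ps) = ∧-true p (≁⇒avoid ps)

  Coclique : List V → Set
  Coclique = AllPairs _≁_

  swap₁₂ : ∀ {a b cs} → Coclique (a ∷ b ∷ cs) → Coclique (b ∷ a ∷ cs)
  swap₁₂ ((ab ∷ as) ∷ bs ∷ ps) = (≁-sym ab ∷ bs) ∷ as ∷ ps

  swap₂₃ : ∀ {a b c ds} → Coclique (a ∷ b ∷ c ∷ ds) → Coclique (a ∷ c ∷ b ∷ ds)
  swap₂₃ ((ab ∷ ac ∷ as) ∷ (bc ∷ bs) ∷ cs ∷ ps) = (ac ∷ ab ∷ as) ∷ (≁-sym bc ∷ cs) ∷ bs ∷ ps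

  delete₃ : ∀ {a b c ds} → Coclique (a ∷ b ∷ c ∷ ds) → Coclique (a ∷ b ∷ ds)
  delete₃ ((ab ∷ ac ∷ as) ∷ (bc ∷ bs) ∷ cs ∷ ps) = (ab ∷ as) ∷ bs ∷ ps

  extend : ∀ {u cs} → avoid cs u ≡ true → Coclique cs → Coclique (u ∷ cs)
  extend {cs = cs} au I = All.map ≁-sym (avoid⇒≁ cs au) ∷ I

  -- Cocliques of size five

  module Coclique₅ {a b c d e : V} (I : Coclique (a ∷ b ∷ c ∷ d ∷ e ∷ [])) where

    five : Vec (V → Bool) 5
    five = (a ~_) ∷ (b ~_) ∷ (c ~_) ∷ (d ~_) ∷ (e ~_) ∷ []

    singles pairs : List (Formula 5)
    singles = (λ a b c d e → a) ∷ (λ a b c d e → b) ∷ (λ a b c d e → c) ∷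
              (λ a b c d e → d) ∷ (λ a b c d e → e) ∷ []
    pairs = (λ a b c d e → a ∧ b) ∷ (λ a b c d e → a ∧ c) ∷ (λ a b c d e → a ∧ d) ∷
            (λ a b c d e → a ∧ e) ∷ (λ a b c d e → b ∧ c) ∷ (λ a b c d e → b ∧ d) ∷
            (λ a b c d e → b ∧ e) ∷ (λ a b c d e → c ∧ d) ∷ (λ a b c d e → c ∧ e) ∷
            (λ a b c d e → d ∧ e) ∷ []

    ⊤∷pairs : List (Formula 5)
    ⊤∷pairs = (λ a b c d e → true) ∷ pairs

    total-singles : total singles five ≡ 130
    total-singles rewrite degree a | degree b | degree c | degree d | degree e = refl

    pairs-≤ : Coclique (a ∷ b ∷ c ∷ d ∷ e ∷ []) →
              All (_≤ 5) (List.map (λ φ → # (λ v → φ ⟨ at five v ⟩)) pairs)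
    pairs-≤ ((ab ∷ ac ∷ ad ∷ ae ∷ []) ∷ (bc ∷ bd ∷ be ∷ []) ∷ (cd ∷ ce ∷ []) ∷ (de ∷ []) ∷ [] ∷ []) =
      common ab ∷ common ac ∷ common ad ∷ common ae ∷ common bc ∷
      common bd ∷ common be ∷ common cd ∷ common ce ∷ common de ∷ []

    -- A vertex in s of the five closed neighbourhoods satisfies s ≤ 1 + s (s - 1) / 2, and summing
    -- gives 5 · 26 ≤ 80 + `total pairs five`. Ten pairs with at most 5 common neighbours each can
    -- only just reach 50.
    total-pairs-≥ : 50 ≤ total pairs five
    total-pairs-≥ = counts {p = total pairs five} total-singles #V
      (count-≤ [] singles ⊤∷pairs five (λ _ → []) refl)
      where
      counts : ∀ {s t p} → s ≡ 130 → t ≡ 80 → s ≤ t + p → 50 ≤ p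
      counts refl refl le = +-cancelˡ-≤ 80 50 _ le

    pairs-≡5 : All (_≡ 5) (List.map (λ φ → # (λ v → φ ⟨ at five v ⟩)) pairs)
    pairs-≡5 = all-tight _ (pairs-≤ I) total-pairs-≥

    -- Equality in s ≤ 1 + s (s - 1) / 2 holds exactly for s = 1 and s = 2.
    covered : ∀ v → once-or-twice ⟨ at five v ⟩ ≡ true
    covered = count-tight [] singles ⊤∷pairs five (λ _ → []) once-or-twice refl refl
      (subst₂ _≤_ (cong₂ _+_ (sym #V) (sym total-pairs)) (sym total-singles) ≤-refl)
      where
      total-pairs : total pairs five ≡ 50
      total-pairs with ab ∷ ac ∷ ad ∷ ae ∷ bc ∷ bd ∷ be ∷ cd ∷ ce ∷ de ∷ [] ← pairs-≡5
        rewrite ab | ac | ad | ae | bc | bd | be | cd | ce | de = refl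

    #-common : # (λ v → a ~ v ∧ b ~ v) ≡ 5
    #-common with ab ∷ _ ← pairs-≡5 = ab

    #-common-cd : # (λ v → c ~ v ∧ d ~ v) ≡ 5
    #-common-cd with _ ∷ _ ∷ _ ∷ _ ∷ _ ∷ _ ∷ _ ∷ cd ∷ _ ← pairs-≡5 = cd

    #-common-ce : # (λ v → c ~ v ∧ e ~ v) ≡ 5
    #-common-ce with _ ∷ _ ∷ _ ∷ _ ∷ _ ∷ _ ∷ _ ∷ _ ∷ ce ∷ _ ← pairs-≡5 = ce

    #-avoid : # (avoid (c ∷ d ∷ e ∷ [])) ≡ 17
    #-avoid with _ ∷ _ ∷ _ ∷ _ ∷ _ ∷ _ ∷ _ ∷ cd ∷ ce ∷ de ∷ [] ← pairs-≡5 =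
      -- No vertex lies in three closed neighbourhoods, so inclusion-exclusion for `c`, `d`, `e`
      -- stops at pairs: 80 - 3 · 26 + 3 · 5 = 17.
      +-cancelʳ-≡ 78 _ _ (counts (degree c) (degree d) (degree e) #V cd ce de
        (count-≡ (once-or-twice ∷ [])
          ((λ a b c d e → none (c ∷ d ∷ e ∷ [])) ∷ (λ a b c d e → c) ∷ (λ a b c d e → d) ∷ (λ a b c d e → e) ∷ [])
          ((λ a b c d e → true) ∷ (λ a b c d e → c ∧ d) ∷ (λ a b c d e → c ∧ e) ∷ (λ a b c d e → d ∧ e) ∷ [])
          five (λ v → covered v ∷ []) refl))
      where
      counts : ∀ {x c d e t cd ce de} → c ≡ 26 → d ≡ 26 → e ≡ 26 → t ≡ 80 → cd ≡ 5 → ce ≡ 5 → de ≡ 5 →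
               x + (c + (d + (e + 0))) ≡ t + (cd + (ce + (de + 0))) → x + 78 ≡ 95
      counts refl refl refl refl refl refl refl eq = eq

    #-avoid-near : # (λ v → avoid (c ∷ d ∷ e ∷ []) v ∧ a ~ v) ≡ 11
    #-avoid-near with _ ∷ ac ∷ ad ∷ ae ∷ _ ← pairs-≡5 =
      -- For the same reason the three sets removed from the closed neighbourhood of `a` are
      -- disjoint: 26 - 3 · 5 = 11.
      +-cancelʳ-≡ 15 _ _ (counts (degree a) ac ad ae
        (count-≡ (once-or-twice ∷ [])
          ((λ a b c d e → none (c ∷ d ∷ e ∷ []) ∧ a) ∷ (λ a b c d e → a ∧ c) ∷ (λ a b c d e → a ∧ d) ∷ (λ a b c d e → a ∧ e) ∷ [])
          ((λ a b c d e → a) ∷ [])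
          five (λ v → covered v ∷ []) refl))
      where
      counts : ∀ {x a ac ad ae} → a ≡ 26 → ac ≡ 5 → ad ≡ 5 → ae ≡ 5 →
               x + (ac + (ad + (ae + 0))) ≡ a + 0 → x + 15 ≡ 26
      counts refl refl refl refl eq = eq

    #-avoid-far : # (λ v → avoid (c ∷ d ∷ e ∷ []) v ∧ not (a ~ v)) ≡ 6
    #-avoid-far = +-cancelˡ-≡ 11 _ _ (counts #-avoid #-avoid-near
      (count-≡ []
        ((λ a b c d e → none (c ∷ d ∷ e ∷ []) ∧ a) ∷ (λ a b c d e → none (c ∷ d ∷ e ∷ []) ∧ not a) ∷ [])
        ((λ a b c d e → none (c ∷ d ∷ e ∷ [])) ∷ [])
        five (λ v → []) refl))
      where
      counts : ∀ {u x y} → u ≡ 17 → x ≡ 11 → x + (y + 0) ≡ u + 0 → 11 + y ≡ 17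
      counts {y = y} refl refl eq = trans (cong (11 +_) (sym (+-identityʳ y))) eq

    -- Two is the maximum, and `a` and `b` exhaust it. Hence `m`, `c`, `d`, `e` is again a coclique.
    far-from-common : ∀ {m} → a ~ m ≡ true → b ~ m ≡ true → All (_≁ m) (c ∷ d ∷ e ∷ [])
    far-from-common {m} am bm =
      entails hs (λ a b c d e → not c) refl (at five m) holds ∷
      entails hs (λ a b c d e → not d) refl (at five m) holds ∷
      entails hs (λ a b c d e → not e) refl (at five m) holds ∷ []
      where
      hs : List (Formula 5)
      hs = once-or-twice ∷ (λ a b c d e → a) ∷ (λ a b c d e → b) ∷ []
      holds : Holds (at five m) hs
      holds = covered m ∷ am ∷ bm ∷ []

  -- Common neighbours that dominate

  open Coclique₅

  -- Such a `p` can replace `c` in the coclique, and `far-from-common` applies to the new one.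
  far-from-exclusive : ∀ {a b c d e m p} → Coclique (a ∷ b ∷ c ∷ d ∷ e ∷ []) →
    a ~ m ≡ true → b ~ m ≡ true → avoid (a ∷ b ∷ d ∷ e ∷ []) p ≡ true → m ≁ p
  far-from-exclusive I am bm away
    with pm ∷ _ ← far-from-common (swap₂₃ (swap₁₂ (extend away (delete₃ I)))) am bm = ≁-sym pm

  -- For a common neighbour `m` of `a` and `b` this is precisely the obstruction to extending the
  -- coclique `m`, `c`, `d`, `e` by a fifth vertex.
  Dominates : V → V → V → V → Set
  Dominates c d e m = ∀ u → avoid (c ∷ d ∷ e ∷ []) u ≡ true → m ~ u ≡ true

  -- If w ≁ w′ then m, w, w′, d, e is a coclique, so 17 vertices avoid m, d and e; but these
  -- are among the 16 neighbours of c that avoid d and e.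
  dominated-clique : ∀ {a b c d e m} → Coclique (a ∷ b ∷ c ∷ d ∷ e ∷ []) →
    a ~ m ≡ true → b ~ m ≡ true → Dominates c d e m →
    ∀ w w′ → avoid (m ∷ d ∷ e ∷ []) w ≡ true → avoid (m ∷ d ∷ e ∷ []) w′ ≡ true → w ~ w′ ≡ true
  dominated-clique {a} {b} {c} {d} {e} {m} I am bm dom w w′ aw aw′ with dichotomy (w ~ w′)
  ... | inj₁ near = near
  ... | inj₂ ww′
    with _ ∷ dm ∷ em ∷ [] ← far-from-common I am bm
    = ⊥-elim (counts (degree c)
        (#-avoid (extend (∧-true (≁-sym ww′) aw) (extend aw′ (extend (≁⇒avoid (dm ∷ em ∷ [])) (tail (tail (tail I)))))))
        (#-common-cd I) (#-common-ce I)
        (count-≤ ((λ m a b c d e → none (c ∷ d ∷ e ∷ []) ⇒ m) ∷ (λ m → once-or-twice) ∷ [])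
          ((λ m a b c d e → none (m ∷ d ∷ e ∷ [])) ∷ (λ m a b c d e → c ∧ d) ∷ (λ m a b c d e → c ∧ e) ∷ [])
          ((λ m a b c d e → c) ∷ [])
          ((m ~_) ∷ five I) (λ v → ⇒-intro (dom v) ∷ covered I v ∷ []) refl))
    where
    counts : ∀ {c x cd ce} → c ≡ 26 → x ≡ 17 → cd ≡ 5 → ce ≡ 5 → x + (cd + (ce + 0)) ≤ c + 0 → ⊥
    counts refl refl refl refl = ≤⇒≤ᵇ

  -- Z is a clique of which every vertex has exactly 6 non-neighbours in D, all outside Z, while
  -- a vertex of D ∖ Z has at most 6 non-neighbours in D.
  module Dominated {a b c d e m : V} (I : Coclique (a ∷ b ∷ c ∷ d ∷ e ∷ []))
    (am : a ~ m ≡ true) (bm : b ~ m ≡ true) (dom : Dominates c d e m) where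

    D Z : V → Bool
    D = avoid (b ∷ d ∷ e ∷ [])
    Z v = (D v ∧ c ~ v) ∧ not (m ~ v)

    #-far-in-D : ∀ {z p} → D z ≡ true → D p ≡ true → z ≁ p → # (λ v → D v ∧ not (z ~ v)) ≡ 6
    #-far-in-D Dz Dp zp =
      #-avoid-far (extend (∧-true (≁-sym zp) Dz) (extend Dp (tail (delete₃ I))))

    Z⇒D : ∀ {v} → Z v ≡ true → D v ≡ true
    Z⇒D Zv = ∧-trueˡ (∧-trueˡ Zv)

    Z⇒m≁ : ∀ {v} → Z v ≡ true → m ≁ v
    Z⇒m≁ {v} Zv = ∧-trueʳ {D v ∧ c ~ v} Zv

    Z-clique : ∀ z w → Z z ≡ true → Z w ≡ true → z ~ w ≡ true
    Z-clique z w Zz Zw = dominated-clique I am bm dom z w (away Zz) (away Zw)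
      where
      away : ∀ {v} → Z v ≡ true → avoid (m ∷ d ∷ e ∷ []) v ≡ true
      away {v} Zv with _ ∷ dv ∷ ev ∷ [] ← avoid⇒≁ (b ∷ d ∷ e ∷ []) (Z⇒D {v} Zv) =
        ≁⇒avoid (Z⇒m≁ {v} Zv ∷ dv ∷ ev ∷ [])

    -- Six vertices avoid `b`, `c`, `d` and `e`, but `z` and `m` have at most five common
    -- neighbours. Since `m` is adjacent to all six, `z` misses one of them.
    far-witness : ∀ {z} → Z z ≡ true → ∃ λ p → D p ≡ true × z ≁ p
    far-witness {z} Zz
      with p , Pp , ¬both ← #-witness (λ v → avoid (c ∷ d ∷ e ∷ []) v ∧ not (b ~ v)) (λ v → z ~ v ∧ m ~ v)
             (subst (# (λ v → z ~ v ∧ m ~ v) <_) (sym (#-avoid-far (swap₁₂ I))) (s≤s (common (≁-sym (Z⇒m≁ Zz)))))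
      = p
      , entails {k = 4} ((λ b c d e → none (c ∷ d ∷ e ∷ []) ∧ not b) ∷ []) (λ b c d e → none (b ∷ d ∷ e ∷ [])) refl
          (b ~ p ∷ c ~ p ∷ d ~ p ∷ e ~ p ∷ []) (Pp ∷ [])
      , entails {k = 2} ((λ z m → not (z ∧ m)) ∷ (λ z m → m) ∷ []) (λ z m → not z) refl
          (z ~ p ∷ m ~ p ∷ []) (¬both ∷ dom p (∧-trueˡ Pp) ∷ [])

    far : V → V → Bool
    far z v = Z z ∧ (D v ∧ not (z ~ v))

    row : ∀ z → ⟦ Z z ⟧ * 6 ≤ # (far z)
    row z with Z z in Zz
    ... | false = z≤n
    ... | true with p , Dp , zp ← far-witness Zz = ≤-reflexive (sym (#-far-in-D (Z⇒D {z} Zz) Dp zp))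

    column : ∀ v → # (λ z → far z v) ≤ ⟦ D v ∧ not (Z v) ⟧ * 6
    column v with dichotomy (D v) | dichotomy (Z v) | search (λ z → Z z ∧ not (z ~ v))
    ... | inj₂ ¬Dv | _ | _ = empty λ z →
      entails ((λ Zz Dv zv → not Dv) ∷ []) (λ Zz Dv zv → not (Zz ∧ (Dv ∧ not zv))) refl
        (Z z ∷ D v ∷ z ~ v ∷ []) (¬Dv ∷ [])
      where
      empty : (∀ z → not (far z v) ≡ true) → # (λ z → far z v) ≤ ⟦ D v ∧ not (Z v) ⟧ * 6
      empty no-far = ≤-trans (≤-reflexive (#-empty _ no-far)) z≤n
    ... | inj₁ _ | inj₁ Zv | _ = ≤-trans (≤-reflexive (#-empty _ λ z →
      entails ((λ Zz Dv zv → Zz ⇒ zv) ∷ []) (λ Zz Dv zv → not (Zz ∧ (Dv ∧ not zv))) refl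
        (Z z ∷ D v ∷ z ~ v ∷ []) (⇒-intro (λ Zz → Z-clique z v Zz Zv) ∷ []))) z≤n
    ... | inj₁ _ | inj₂ _ | inj₂ no-far = ≤-trans (≤-reflexive (#-empty _ λ z →
      entails ((λ Zz Dv zv → not (Zz ∧ not zv)) ∷ []) (λ Zz Dv zv → not (Zz ∧ (Dv ∧ not zv))) refl
        (Z z ∷ D v ∷ z ~ v ∷ []) (no-far z ∷ []))) z≤n
    ... | inj₁ Dv | inj₂ ¬Zv | inj₁ (z , Zz∧zv) = subst (λ b → # (λ z → far z v) ≤ ⟦ b ⟧ * 6)
      (sym (∧-true Dv ¬Zv))
      (≤-trans
        (#-mono λ w fw → ∧-true (Z⇒D {w} (∧-trueˡ fw)) (≁-sym (∧-trueʳ {D v} (∧-trueʳ {Z w} fw))))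
        (≤-reflexive (#-far-in-D Dv (Z⇒D {z} (∧-trueˡ Zz∧zv)) (≁-sym (∧-trueʳ {Z z} Zz∧zv)))))

    #Z≤#D∖Z : # Z * 6 ≤ # (λ v → D v ∧ not (Z v)) * 6
    #Z≤#D∖Z = begin
      # Z * 6                                ≡⟨ *-distribʳ-sum 6 (λ z → ⟦ Z z ⟧) ⟩
      sum (λ z → ⟦ Z z ⟧ * 6)                ≤⟨ sum-mono-≤ _ _ row ⟩
      sum (λ z → # (far z))                  ≡⟨ ∑-comm (λ z v → ⟦ far z v ⟧) ⟩
      sum (λ v → # (λ z → far z v))          ≤⟨ sum-mono-≤ _ _ column ⟩
      sum (λ v → ⟦ D v ∧ not (Z v) ⟧ * 6)    ≡⟨ *-distribʳ-sum 6 (λ v → ⟦ D v ∧ not (Z v) ⟧) ⟨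
      # (λ v → D v ∧ not (Z v)) * 6          ∎
      where open ≤-Reasoning

    -- `Z` is at most half of the 17 vertices of `D`.
    #Z≤8 : # Z ≤ 8
    #Z≤8 = counts #Z≤#D∖Z (#-avoid (swap₂₃ I))
      (count-≡ ((λ d z → z ⇒ d) ∷ []) ((λ d z → z) ∷ (λ d z → d ∧ not z) ∷ []) ((λ d z → d) ∷ [])
        (D ∷ Z ∷ []) (λ v → ⇒-intro (Z⇒D {v}) ∷ []) refl)
      where
      counts : ∀ {z y d} → z * 6 ≤ y * 6 → d ≡ 17 → z + (y + 0) ≡ d + 0 → z ≤ 8
      counts {z} {y} 6z≤6y refl eq rewrite +-identityʳ y = ≮⇒≥ λ 9≤z →
        ≤⇒≤ᵇ {18} {17} (≤-trans (+-mono-≤ 9≤z (≤-trans 9≤z (*-cancelʳ-≤ z y 6 6z≤6y))) (≤-reflexive eq))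

  -- Of the 11 closed neighbours of `c` avoiding `b`, `d`, `e`, at most 8 are missed by `m`. The
  -- others cannot be seen by `c` only, by `far-from-exclusive`, so they are adjacent to `a`.
  common-≥3 : ∀ {a b c d e m} → Coclique (a ∷ b ∷ c ∷ d ∷ e ∷ []) →
    a ~ m ≡ true → b ~ m ≡ true → Dominates c d e m →
    3 ≤ # (λ v → m ~ v ∧ (a ~ v ∧ c ~ v))
  common-≥3 {a} {b} {c} {d} {e} {m} I am bm dom = +-cancelˡ-≤ 8 _ _ (counts
    (#-avoid-near (swap₁₂ (swap₂₃ I))) (Dominated.#Z≤8 I am bm dom)
    (count-≤ ((λ m a b c d e → none (a ∷ b ∷ d ∷ e ∷ []) ⇒ not m) ∷ [])
      ((λ m a b c d e → none (b ∷ d ∷ e ∷ []) ∧ c) ∷ [])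
      ((λ m a b c d e → (none (b ∷ d ∷ e ∷ []) ∧ c) ∧ not m) ∷ (λ m a b c d e → m ∧ (a ∧ c)) ∷ [])
      ((m ~_) ∷ five I) (λ v → ⇒-intro (far-from-exclusive I am bm) ∷ []) refl))
    where
    counts : ∀ {x z y} → x ≡ 11 → z ≤ 8 → x + 0 ≤ z + (y + 0) → 8 + 3 ≤ 8 + y
    counts {z = z} {y} refl z≤8 le rewrite +-identityʳ y = ≤-trans le (+-monoˡ-≤ y z≤8)

  -- By symmetry in `a` and `b`, the nonadjacent `m` and `c` would have three common neighbours
  -- adjacent to `a` and three adjacent to `b`. No vertex is adjacent to all of `a`, `b`, `c`, so
  -- these are six, against the bound 5.
  not-dominated : ∀ {a b c d e m} → Coclique (a ∷ b ∷ c ∷ d ∷ e ∷ []) →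
    a ~ m ≡ true → b ~ m ≡ true → ¬ Dominates c d e m
  not-dominated {c = c} {m = m} I am bm dom with mc ∷ _ ← far-from-common I am bm =
    counts (common-≥3 I am bm dom) (common-≥3 (swap₁₂ I) bm am dom) (common (≁-sym mc))
      (count-≤ (once-or-twice′ ∷ [])
        ((λ m a b c d e → m ∧ (a ∧ c)) ∷ (λ m a b c d e → m ∧ (b ∧ c)) ∷ [])
        ((λ m a b c d e → m ∧ c) ∷ [])
        ((m ~_) ∷ five I) (λ v → covered I v ∷ []) refl)
    where
    once-or-twice′ : Formula 6
    once-or-twice′ m = once-or-twice
    counts : ∀ {x y z} → 3 ≤ x → 3 ≤ y → z ≤ 5 → x + (y + 0) ≤ z + 0 → ⊥
    counts 3≤x 3≤y z≤5 le =
      ≤⇒≤ᵇ {6} {5} (≤-trans (+-mono-≤ 3≤x (+-monoˡ-≤ 0 3≤y)) (≤-trans le (+-monoˡ-≤ 0 z≤5)))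

  -- Some `z` makes `m`, `c`, `z`, `d`, `e` a 5-coclique, so `m` and `c` have exactly 5 common
  -- neighbours, and these avoid `d` and `e`. By `far-from-exclusive` each of them is adjacent to
  -- `a` or `b`, and not to both since it is adjacent to `c`.
  common-split : ∀ {a b c d e m} → Coclique (a ∷ b ∷ c ∷ d ∷ e ∷ []) →
    a ~ m ≡ true → b ~ m ≡ true →
    # (λ v → m ~ v ∧ (a ~ v ∧ c ~ v)) + # (λ v → m ~ v ∧ (b ~ v ∧ c ~ v)) ≡ 5
  common-split {a} {b} {c} {d} {e} {m} I am bm
    with search (λ u → avoid (c ∷ d ∷ e ∷ []) u ∧ not (m ~ u))
  ... | inj₂ none-far = ⊥-elim (not-dominated I am bm λ u au →
          entails {k = 2} ((λ p q → not (p ∧ not q)) ∷ (λ p q → p) ∷ []) (λ p q → q) refl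
            (avoid (c ∷ d ∷ e ∷ []) u ∷ m ~ u ∷ []) (none-far u ∷ au ∷ []))
  ... | inj₁ (z , far) = counts {# (λ v → m ~ v ∧ (a ~ v ∧ c ~ v))} {# (λ v → m ~ v ∧ (b ~ v ∧ c ~ v))} (#-common I″)
      (count-≡ ((λ m z → once-or-twice) ∷ (λ m z a b c d e → once-or-twice m c z d e) ∷
                (λ m z a b c d e → none (a ∷ b ∷ d ∷ e ∷ []) ⇒ not m) ∷ [])
        ((λ m z a b c d e → m ∧ (a ∧ c)) ∷ (λ m z a b c d e → m ∧ (b ∧ c)) ∷ [])
        ((λ m z a b c d e → m ∧ c) ∷ [])
        ((m ~_) ∷ (z ~_) ∷ five I)
        (λ v → covered I v ∷ covered I″ v ∷ ⇒-intro (far-from-exclusive I am bm) ∷ [])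
        refl)
    where
    I′ : Coclique (z ∷ m ∷ c ∷ d ∷ e ∷ [])
    I′ = extend {cs = m ∷ _} (∧-true (∧-trueʳ {avoid (c ∷ d ∷ e ∷ []) z} far) (∧-trueˡ {avoid (c ∷ d ∷ e ∷ []) z} far))
           (extend (≁⇒avoid (far-from-common I am bm)) (tail (tail I)))
    I″ : Coclique (m ∷ c ∷ z ∷ d ∷ e ∷ [])
    I″ = swap₂₃ (swap₁₂ I′)
    counts : ∀ {x y z} → z ≡ 5 → x + (y + 0) ≡ z + 0 → x + y ≡ 5
    counts {x} {y} refl eq = trans (cong (x +_) (sym (+-identityʳ y))) eq

  -- Parity of edge counts, and existence of 4-cocliques

  M : V → V → V → Bool
  M a b v = a ~ v ∧ b ~ v

  -- The reflexive `~` adds no loops when two of the sets `M` of a 5-coclique are inserted, as these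
  -- are disjoint.
  edges : (V → Bool) → (V → Bool) → ℕ
  edges p q = sum (λ u → ⟦ p u ⟧ * # (λ v → u ~ v ∧ q v))

  edges-sym : ∀ p q → edges p q ≡ edges q p
  edges-sym p q = trans (double-sum p q _~_)
    (sum-cong-≗ λ v → cong (⟦ q v ⟧ *_) (sum-cong-≗ λ u → cong (λ b → ⟦ b ∧ p u ⟧) (~-sym u v)))

  -- By `common-split` each of the 5 members of `M a b` contributes 5.
  edges-M : ∀ {a b c d e} → Coclique (a ∷ b ∷ c ∷ d ∷ e ∷ []) →
            edges (M a b) (M a c) + edges (M a b) (M b c) ≡ 25
  edges-M {a} {b} {c} I = begin
    edges (M a b) (M a c) + edges (M a b) (M b c)                            ≡⟨ ∑-distrib-+ (λ u → ⟦ M a b u ⟧ * # (λ v → u ~ v ∧ M a c v)) (λ u → ⟦ M a b u ⟧ * # (λ v → u ~ v ∧ M b c v)) ⟨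
    sum (λ u → ⟦ M a b u ⟧ * # (λ v → u ~ v ∧ M a c v) + ⟦ M a b u ⟧ * # (λ v → u ~ v ∧ M b c v))
                                                                             ≡⟨ sum-cong-≗ (λ u → pointwise u (M a b u) refl) ⟩
    sum (λ u → ⟦ M a b u ⟧ * 5)                                              ≡⟨ *-distribʳ-sum 5 (λ u → ⟦ M a b u ⟧) ⟨
    # (M a b) * 5                                                            ≡⟨ cong (_* 5) (#-common I) ⟩
    25                                                                       ∎
    where
    open ≡-Reasoning
    pointwise : ∀ u x → M a b u ≡ x →
      ⟦ x ⟧ * # (λ v → u ~ v ∧ M a c v) + ⟦ x ⟧ * # (λ v → u ~ v ∧ M b c v) ≡ ⟦ x ⟧ * 5
    pointwise u false _  = refl
    pointwise u true  Mu rewrite *-identityˡ (# (λ v → u ~ v ∧ M a c v)) | *-identityˡ (# (λ v → u ~ v ∧ M b c v)) =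
      common-split I (∧-trueˡ Mu) (∧-trueʳ {a ~ u} Mu)

  edges-congʳ : ∀ p {q r} → (∀ v → q v ≡ r v) → edges p q ≡ edges p r
  edges-congʳ p q≗r = sum-cong-≗ λ u → cong (⟦ p u ⟧ *_) (sum-cong-≗ λ v → cong (λ b → ⟦ u ~ v ∧ b ⟧) (q≗r v))

  M-comm : ∀ a b v → M a b v ≡ M b a v
  M-comm a b v = Bool.∧-comm (a ~ v) (b ~ v)

  no-coclique₅ : ∀ {a b c d e} → ¬ Coclique (a ∷ b ∷ c ∷ d ∷ e ∷ [])
  no-coclique₅ {a} {b} {c} I = 
    odd-sum {edges (M a b) (M a c)} {edges (M a b) (M b c)} {edges (M a c) (M b c)} (edges-M I) ab-bc ac-bc
    where
    ac-bc : edges (M a b) (M a c) + edges (M a c) (M b c) ≡ 25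
    ac-bc = trans (cong₂ _+_ (edges-sym (M a b) (M a c)) (edges-congʳ (M a c) (M-comm b c))) (edges-M (swap₂₃ I))
    ab-bc : edges (M a b) (M b c) + edges (M a c) (M b c) ≡ 25
    ab-bc = trans (cong₂ _+_
        (trans (edges-sym (M a b) (M b c)) (edges-congʳ (M b c) (M-comm a b)))
        (trans (edges-sym (M a c) (M b c)) (edges-congʳ (M b c) (M-comm a c))))
      (edges-M (swap₂₃ (swap₁₂ I)))
    odd-sum : ∀ {x y z} → x + y ≡ 25 → y + z ≡ 25 → x + z ≡ 25 → ⊥
    -- The last two equations give `x ≡ y`, and then the first makes 25 even.
    odd-sum {x} {y} {z} xy yz xz = even≢odd x 12 (trans (cong (x +_) (+-identityʳ x))
      (trans (cong (x +_) (+-cancelʳ-≡ z x y (trans xz (sym yz)))) xy))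

  #-near : ∀ cs → # (λ v → not (avoid cs v)) ≤ List.length cs * 26
  #-near []       = ≤-reflexive (#-empty {n} (λ _ → false) λ _ → refl)
  #-near (c ∷ cs) = counts {# (λ v → not (avoid (c ∷ cs) v))} (degree c) (#-near cs)
    (count-≤ [] ((λ c r → not (not c ∧ r)) ∷ []) ((λ c r → c) ∷ (λ c r → not r) ∷ [])
      ((c ~_) ∷ avoid cs ∷ []) (λ _ → []) refl)
    where
    counts : ∀ {x y r m} → y ≡ 26 → r ≤ m → x + 0 ≤ y + (r + 0) → x ≤ 26 + m
    counts {x} {r = r} refl r≤m le rewrite +-identityʳ x | +-identityʳ r = ≤-trans le (+-monoʳ-≤ 26 r≤m)

  -- Union bound. It allows a greedy choice of four vertices because 3 · 26 = 78 < 80.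
  extendable : ∀ cs → List.length cs * 26 < 80 → ∃ λ v → avoid cs v ≡ true
  extendable cs small with #-witness {n} (λ _ → true) (λ v → not (avoid cs v))
    (subst (# (λ v → not (avoid cs v)) <_) (sym #V) (≤-<-trans (#-near cs) small))
  ... | v , _ , p = v , trans (sym (Bool.not-involutive _)) p

  coclique₄ : ∃ λ a → ∃ λ b → ∃ λ c → ∃ λ d → Coclique (a ∷ b ∷ c ∷ d ∷ [])
  coclique₄
    with d , _  ← extendable [] (≤ᵇ-true refl)
    with c , pc ← extendable (d ∷ []) (≤ᵇ-true refl)
    with b , pb ← extendable (c ∷ d ∷ []) (≤ᵇ-true refl)
    with a , pa ← extendable (b ∷ c ∷ d ∷ []) (≤ᵇ-true refl)
    = a , b , c , d , extend pa (extend pb (extend pc ([] ∷ [])))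

  -- Clusters of a 4-coclique

  private variable
    a b c d u v w : V
    cs ds : List V

  maximal : Coclique (a ∷ b ∷ c ∷ d ∷ []) → ∀ v → not (avoid (a ∷ b ∷ c ∷ d ∷ []) v) ≡ true
  maximal {a} {b} {c} {d} I v with dichotomy (avoid (a ∷ b ∷ c ∷ d ∷ []) v)
  ... | inj₁ av = ⊥-elim (no-coclique₅ (extend av I))
  ... | inj₂ ¬av = ¬av

  -- The vertex `a` shares at most 5 of its 26 closed neighbours with each of `b`, `c`, `d`, which
  -- leaves 26 - 15.
  exclusive-≥11 : Coclique (a ∷ b ∷ c ∷ d ∷ []) → 11 ≤ # (avoid (b ∷ c ∷ d ∷ []))
  exclusive-≥11 {a} {b} {c} {d} ((ab ∷ ac ∷ ad ∷ []) ∷ _) =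
    counts (degree a) (common ab) (common ac) (common ad)
      (count-≤ [] ((λ a b c d → a) ∷ [])
        ((λ a b c d → a ∧ b) ∷ (λ a b c d → a ∧ c) ∷ (λ a b c d → a ∧ d) ∷ (λ a b c d → none (b ∷ c ∷ d ∷ [])) ∷ [])
        ((a ~_) ∷ (b ~_) ∷ (c ~_) ∷ (d ~_) ∷ []) (λ _ → []) refl)
    where
    counts : ∀ {x ab ac ad p} → x ≡ 26 → ab ≤ 5 → ac ≤ 5 → ad ≤ 5 → x + 0 ≤ ab + (ac + (ad + (p + 0))) → 11 ≤ p
    counts {p = p} refl ab ac ad le rewrite +-identityʳ p =
      +-cancelˡ-≤ 15 11 p (≤-trans le (+-mono-≤ ab (+-mono-≤ ac (+-monoˡ-≤ p ad))))

  -- Two nonadjacent such vertices would extend `b`, `c`, `d` to a 5-coclique.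
  exclusive-clique : Coclique (b ∷ c ∷ d ∷ []) →
    avoid (b ∷ c ∷ d ∷ []) u ≡ true → avoid (b ∷ c ∷ d ∷ []) w ≡ true → u ~ w ≡ true
  exclusive-clique {u = u} {w} I au aw with dichotomy (u ~ w)
  ... | inj₁ uw = uw
  ... | inj₂ uw = ⊥-elim (no-coclique₅ (extend (∧-true (≁-sym uw) au) (extend aw I)))

  Complete : List V → V → Set
  Complete cs v = ∀ u → avoid cs u ≡ true → v ~ u ≡ true

  -- For a coclique a, b, c, d the cluster of a is complete (b ∷ c ∷ d ∷ []), since the vertices
  -- avoiding b, c and d are those seen by a only.
  complete : List V → V → Bool
  complete cs v with search (λ u → avoid cs u ∧ not (v ~ u))
  ... | inj₁ _ = false
  ... | inj₂ _ = true

  complete-sound : ∀ cs v → complete cs v ≡ true → Complete cs v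
  complete-sound cs v _ u au with search (λ u → avoid cs u ∧ not (v ~ u))
  ... | inj₂ none-far = entails {k = 2} ((λ p q → not (p ∧ not q)) ∷ (λ p q → p) ∷ []) (λ p q → q) refl
                          (avoid cs u ∷ v ~ u ∷ []) (none-far u ∷ au ∷ [])

  incomplete : ∀ cs v → not (complete cs v) ≡ true → ∃ λ u → avoid cs u ≡ true × v ≁ u
  incomplete cs v _ with search (λ u → avoid cs u ∧ not (v ~ u))
  ... | inj₁ (u , far) = u , ∧-trueˡ far , ∧-trueʳ {avoid cs u} far

  complete-complete : ∀ cs v → Complete cs v → complete cs v ≡ true
  complete-complete cs v comp with dichotomy (complete cs v)
  ... | inj₁ yes-complete = yes-complete
  ... | inj₂ no-complete with u , au , vu ← incomplete cs v no-complete = contradictory (comp u au) vu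

  -- Two members are both adjacent to the 11 or more vertices seen by `a` only, too many common
  -- neighbours for a nonadjacent pair.
  cluster-clique : Coclique (a ∷ b ∷ c ∷ d ∷ []) → ∀ u v →
    complete (b ∷ c ∷ d ∷ []) u ≡ true → complete (b ∷ c ∷ d ∷ []) v ≡ true → u ~ v ≡ true
  cluster-clique {b = b} {c} {d} I u v cu cv with dichotomy (u ~ v)
  ... | inj₁ uv = uv
  ... | inj₂ uv = ⊥-elim (≤⇒≤ᵇ {11} {5} (≤-trans (exclusive-≥11 I) (≤-trans
    (#-mono λ w aw → ∧-true (complete-sound _ u cu w aw) (complete-sound _ v cv w aw)) (common uv))))

  edge-dominates : Coclique (u ∷ w ∷ c ∷ d ∷ []) → ∀ v → (avoid (c ∷ d ∷ []) v ⇒ u ~ v ∨ w ~ v) ≡ true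
  edge-dominates {u} {w} {c} {d} I v =
    entails {k = 4} ((λ x y c d → not (none (x ∷ y ∷ c ∷ d ∷ []))) ∷ []) (λ x y c d → none (c ∷ d ∷ []) ⇒ x ∨ y) refl
      (u ~ v ∷ w ~ v ∷ c ~ v ∷ d ~ v ∷ []) (maximal I v ∷ [])

  #-avoid₂-≥28 : ∀ c d → 28 ≤ # (avoid (c ∷ d ∷ []))
  #-avoid₂-≥28 c d = counts (degree c) (degree d) #V
    (count-≤ [] ((λ c d → true) ∷ []) ((λ c d → c) ∷ (λ c d → d) ∷ (λ c d → none (c ∷ d ∷ [])) ∷ [])
      ((c ~_) ∷ (d ~_) ∷ []) (λ _ → []) refl)
    where
    counts : ∀ {c d t p} → c ≡ 26 → d ≡ 26 → t ≡ 80 → t + 0 ≤ c + (d + (p + 0)) → 28 ≤ p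
    counts {p = p} refl refl refl le rewrite +-identityʳ p = +-cancelˡ-≤ 52 28 p le

  -- No two consecutive vertices of the pentagon miss the same v, so v is adjacent to
  -- two consecutive ones; but only 5 · 5 < 28 vertices are.
  no-pentagon : ∀ {v₀ v₁ v₂ v₃ v₄ c d} →
    Coclique (v₀ ∷ v₁ ∷ c ∷ d ∷ []) → Coclique (v₁ ∷ v₂ ∷ c ∷ d ∷ []) → Coclique (v₂ ∷ v₃ ∷ c ∷ d ∷ []) →
    Coclique (v₃ ∷ v₄ ∷ c ∷ d ∷ []) → Coclique (v₄ ∷ v₀ ∷ c ∷ d ∷ []) → ⊥
  no-pentagon {v₀} {v₁} {v₂} {v₃} {v₄} {c} {d} I₀ I₁ I₂ I₃ I₄ =
    counts (#-avoid₂-≥28 c d) (pair I₀) (pair I₁) (pair I₂) (pair I₃) (pair I₄)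
      (count-≤
        ((λ c d v₀ v₁ v₂ v₃ v₄ → none (c ∷ d ∷ []) ⇒ v₀ ∨ v₁) ∷ (λ c d v₀ v₁ v₂ v₃ v₄ → none (c ∷ d ∷ []) ⇒ v₁ ∨ v₂) ∷
         (λ c d v₀ v₁ v₂ v₃ v₄ → none (c ∷ d ∷ []) ⇒ v₂ ∨ v₃) ∷ (λ c d v₀ v₁ v₂ v₃ v₄ → none (c ∷ d ∷ []) ⇒ v₃ ∨ v₄) ∷
         (λ c d v₀ v₁ v₂ v₃ v₄ → none (c ∷ d ∷ []) ⇒ v₄ ∨ v₀) ∷ [])
        ((λ c d v₀ v₁ v₂ v₃ v₄ → none (c ∷ d ∷ [])) ∷ [])
        ((λ c d v₀ v₁ v₂ v₃ v₄ → v₀ ∧ v₁) ∷ (λ c d v₀ v₁ v₂ v₃ v₄ → v₁ ∧ v₂) ∷ (λ c d v₀ v₁ v₂ v₃ v₄ → v₂ ∧ v₃) ∷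
         (λ c d v₀ v₁ v₂ v₃ v₄ → v₃ ∧ v₄) ∷ (λ c d v₀ v₁ v₂ v₃ v₄ → v₄ ∧ v₀) ∷ [])
        ((c ~_) ∷ (d ~_) ∷ (v₀ ~_) ∷ (v₁ ~_) ∷ (v₂ ~_) ∷ (v₃ ~_) ∷ (v₄ ~_) ∷ [])
        (λ v → edge-dominates I₀ v ∷ edge-dominates I₁ v ∷ edge-dominates I₂ v ∷ edge-dominates I₃ v ∷ edge-dominates I₄ v ∷ [])
        refl)
    where
    pair : Coclique (u ∷ v ∷ cs) → # (λ w → u ~ w ∧ v ~ w) ≤ 5
    pair ((uv ∷ _) ∷ _) = common uv
    counts : ∀ {x p q r s t} → 28 ≤ x → p ≤ 5 → q ≤ 5 → r ≤ 5 → s ≤ 5 → t ≤ 5 →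
             x + 0 ≤ p + (q + (r + (s + (t + 0)))) → ⊥
    counts x p q r s t le = ≤⇒≤ᵇ {28} {25} (≤-trans (+-monoˡ-≤ 0 x) (≤-trans le
      (+-mono-≤ p (+-mono-≤ q (+-mono-≤ r (+-mono-≤ s (+-monoˡ-≤ 0 t)))))))

  -- Otherwise `v` misses some `z` seen by `a` only and some `w` seen by `b` only. Then `v`, `z`,
  -- `b`, `a`, `w` is a pentagon in the complement whose vertices all avoid `c` and `d`.
  attached : Coclique (a ∷ b ∷ c ∷ d ∷ []) → ∀ v → avoid (c ∷ d ∷ []) v ≡ true →
             Complete (b ∷ c ∷ d ∷ []) v ⊎ Complete (a ∷ c ∷ d ∷ []) v
  attached {a} {b} {c} {d} I@((ab ∷ ac ∷ ad ∷ []) ∷ Ibcd@(_ ∷ Icd)) v av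
    with dichotomy (complete (b ∷ c ∷ d ∷ []) v) | dichotomy (complete (a ∷ c ∷ d ∷ []) v)
  ... | inj₁ near | _ = inj₁ (complete-sound _ v near)
  ... | inj₂ _ | inj₁ near = inj₂ (complete-sound _ v near)
  ... | inj₂ far₁ | inj₂ far₂
    with z , az , vz ← incomplete _ v far₁
       | w , aw , vw ← incomplete _ v far₂
    = ⊥-elim (no-pentagon {v} {z} {b} {a} {w}
        (extend (∧-true (≁-sym vz) av) (extend (∧-trueʳ {not (b ~ z)} az) Icd))
        (extend az Ibcd)
        (swap₁₂ I)
        (swap₁₂ (extend aw (delete₂ I)))
        (swap₁₂ (extend (∧-true (≁-sym vw) av) (extend (∧-trueʳ {not (a ~ w)} aw) Icd))))
    where
    delete₂ : ∀ {x y xs} → Coclique (x ∷ y ∷ xs) → Coclique (x ∷ xs)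
    delete₂ ((_ ∷ us) ∷ _ ∷ ps) = us ∷ ps

  ℓ : V → V → V → V → Bool
  ℓ b c d = complete (b ∷ c ∷ d ∷ [])

  -- Some `w` avoiding `cs` is missed by `t`, while every member of the cluster is adjacent to `w`.
  -- Members adjacent to `t` are thus common neighbours of `t` and `w`.
  common-cluster-≤5 : ∀ cs t → not (complete cs t) ≡ true → # (λ v → t ~ v ∧ complete cs v) ≤ 5
  common-cluster-≤5 cs t far with w , aw , tw ← incomplete cs t far =
    ≤-trans (#-mono λ v p → ∧-true (∧-trueˡ p) (~-flip (complete-sound cs v (∧-trueʳ {t ~ v} p) w aw))) (common tw)

  outside-cluster : ∀ cs x → avoid cs x ≡ true → x ≁ v → not (complete cs v) ≡ true
  outside-cluster {v} cs x ax xv with dichotomy (complete cs v)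
  ... | inj₁ near = contradictory (complete-sound cs v near x ax) (≁-sym xv)
  ... | inj₂ far  = far

  in-own-cluster : Coclique (a ∷ b ∷ c ∷ d ∷ []) → ℓ b c d a ≡ true
  in-own-cluster (as ∷ I) =
    complete-complete _ _ λ u au → exclusive-clique I (≁⇒avoid (All.map ≁-sym as)) au

  -- Of the 11 or more vertices seen by `c` only, at most 5 + 5 are common neighbours of `t` and `w`
  -- or of `c` and `x`. Any other `y` among them is adjacent to `w` and to `c`, hence to neither `t`
  -- nor `x`.
  far-exclusive : Coclique (a ∷ b ∷ c ∷ d ∷ []) → ∀ t x w →
    c ≁ x → avoid (a ∷ b ∷ d ∷ []) w ≡ true → t ≁ w →
    ∃ λ y → avoid (a ∷ b ∷ d ∷ []) y ≡ true × t ≁ y × x ≁ y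
  far-exclusive {a} {b} {c} {d} I t x w cx aw tw =
    let y , ay , far = #-witness (avoid (a ∷ b ∷ d ∷ [])) (λ v → (t ~ v ∧ w ~ v) ∨ (c ~ v ∧ x ~ v))
          (<-≤-trans (s≤s few) (exclusive-≥11 I′))
        hs = (λ t w c x → not ((t ∧ w) ∨ (c ∧ x))) ∷ (λ t w c x → w) ∷ (λ t w c x → c) ∷ []
        holds = far ∷ exclusive-clique (tail I′) aw ay ∷ near ay (maximal I y) ∷ []
        bs = t ~ y ∷ w ~ y ∷ c ~ y ∷ x ~ y ∷ []
    in y , ay , entails {k = 4} hs (λ t w c x → not t) refl bs holds ,
                entails {k = 4} hs (λ t w c x → not x) refl bs holds
    where
    I′ : Coclique (c ∷ a ∷ b ∷ d ∷ [])
    I′ = swap₁₂ (swap₂₃ I)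
    few : # (λ v → (t ~ v ∧ w ~ v) ∨ (c ~ v ∧ x ~ v)) ≤ 10
    few = counts (common tw) (common cx)
      (count-≤ [] ((λ t w c x → (t ∧ w) ∨ (c ∧ x)) ∷ []) ((λ t w c x → t ∧ w) ∷ (λ t w c x → c ∧ x) ∷ [])
        ((t ~_) ∷ (w ~_) ∷ (c ~_) ∷ (x ~_) ∷ []) (λ _ → []) refl)
      where
      counts : ∀ {x y z} → y ≤ 5 → z ≤ 5 → x + 0 ≤ y + (z + 0) → x ≤ 10
      counts {x} y≤5 z≤5 le rewrite +-identityʳ x = ≤-trans le (+-mono-≤ y≤5 (+-monoˡ-≤ 0 z≤5))
    near : ∀ {y} → avoid (a ∷ b ∷ d ∷ []) y ≡ true → not (avoid (a ∷ b ∷ c ∷ d ∷ []) y) ≡ true → c ~ y ≡ true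
    near {y} ay max = entails {k = 4}
      ((λ a b c d → none (a ∷ b ∷ d ∷ [])) ∷ (λ a b c d → not (none (a ∷ b ∷ c ∷ d ∷ []))) ∷ []) (λ a b c d → c) refl
      (a ~ y ∷ b ~ y ∷ c ~ y ∷ d ~ y ∷ []) (ay ∷ max ∷ [])

  -- Vertices outside all four clusters

  incomplete-resp : ∀ cs ds → (∀ u → avoid cs u ≡ true → avoid ds u ≡ true) →
                    not (complete cs v) ≡ true → not (complete ds v) ≡ true
  incomplete-resp {v} cs ds cs⇒ds far with x , ax , vx ← incomplete cs v far =
    outside-cluster ds x (cs⇒ds x ax) (≁-sym vx)

  Unclustered : V → V → V → V → V → Set
  Unclustered a b c d v =
    All (λ cs → not (complete cs v) ≡ true)
        ((b ∷ c ∷ d ∷ []) ∷ (a ∷ c ∷ d ∷ []) ∷ (a ∷ b ∷ d ∷ []) ∷ (a ∷ b ∷ c ∷ []) ∷ [])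

  avoid-swap : ∀ x y cs u → avoid (x ∷ y ∷ cs) u ≡ true → avoid (y ∷ x ∷ cs) u ≡ true
  avoid-swap x y cs u au = entails {k = 3} ((λ x y r → not x ∧ (not y ∧ r)) ∷ []) (λ x y r → not y ∧ (not x ∧ r)) refl
    (x ~ u ∷ y ~ u ∷ avoid cs u ∷ []) (au ∷ [])

  avoid-prep : ∀ x cs ds → (∀ u → avoid cs u ≡ true → avoid ds u ≡ true) →
               ∀ u → avoid (x ∷ cs) u ≡ true → avoid (x ∷ ds) u ≡ true
  avoid-prep x cs ds cs⇒ds u au = ∧-true (∧-trueˡ {not (x ~ u)} au) (cs⇒ds u (∧-trueʳ {not (x ~ u)} au))

  -- Permuting the centres permutes the clusters, but it also reorders the lists that define them;
  -- hence the transports along `incomplete-resp`.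
  unclustered₁₂ : ∀ a b c d {v} → Unclustered a b c d v → Unclustered b a c d v
  unclustered₁₂ a b c d (p ∷ q ∷ r ∷ s ∷ []) =
    q ∷ p ∷ incomplete-resp (a ∷ b ∷ d ∷ []) (b ∷ a ∷ d ∷ []) (avoid-swap a b (d ∷ [])) r ∷ incomplete-resp (a ∷ b ∷ c ∷ []) (b ∷ a ∷ c ∷ []) (avoid-swap a b (c ∷ [])) s ∷ []

  unclustered₂₃ : ∀ a b c d {v} → Unclustered a b c d v → Unclustered a c b d v
  unclustered₂₃ a b c d (p ∷ q ∷ r ∷ s ∷ []) =
    incomplete-resp (b ∷ c ∷ d ∷ []) (c ∷ b ∷ d ∷ []) (avoid-swap b c (d ∷ [])) p ∷ r ∷ q ∷
    incomplete-resp (a ∷ b ∷ c ∷ []) (a ∷ c ∷ b ∷ []) (avoid-prep a (b ∷ c ∷ []) (c ∷ b ∷ []) (avoid-swap b c [])) s ∷ []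

  unclustered₃₄ : ∀ a b c d {v} → Unclustered a b c d v → Unclustered a b d c v
  unclustered₃₄ a b c d (p ∷ q ∷ r ∷ s ∷ []) =
    incomplete-resp (b ∷ c ∷ d ∷ []) (b ∷ d ∷ c ∷ []) (avoid-prep b (c ∷ d ∷ []) (d ∷ c ∷ []) (avoid-swap c d [])) p ∷
    incomplete-resp (a ∷ c ∷ d ∷ []) (a ∷ d ∷ c ∷ []) (avoid-prep a (c ∷ d ∷ []) (d ∷ c ∷ []) (avoid-swap c d [])) q ∷ s ∷ r ∷ []

  swap₃₄ : Coclique (a ∷ b ∷ c ∷ d ∷ cs) → Coclique (a ∷ b ∷ d ∷ c ∷ cs)
  swap₃₄ ((ab ∷ ac ∷ ad ∷ as) ∷ (bc ∷ bd ∷ bs) ∷ (cd ∷ cs) ∷ ds ∷ ps) =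
    (ab ∷ ad ∷ ac ∷ as) ∷ (bd ∷ bc ∷ bs) ∷ (≁-sym cd ∷ ds) ∷ cs ∷ ps

  -- Replace b and c by vertices x and y such that t, d, x, y is a coclique.  The clique of vertices
  -- seen by t only has at least 11 members, among at most 6 fat vertices and at most 5 neighbours
  -- of t in the cluster of a; hence it contains all of these, in particular a.
  centre-dominates : ∀ {fat : V → Bool} → Coclique (a ∷ b ∷ c ∷ d ∷ []) → # fat ≤ 6 →
    (∀ v → not (fat v) ≡ true → ¬ Unclustered a b c d v) →
    ∀ t → (∀ v → fat v ≡ true → t ~ v ≡ true) → t ~ a ≡ true → t ≁ d → Unclustered a b c d t →
    ∀ v → fat v ≡ true → a ~ v ≡ true
  centre-dominates {a} {b} {c} {d} {fat} I@((ab ∷ ac ∷ ad ∷ []) ∷ (bc ∷ bd ∷ []) ∷ (cd ∷ []) ∷ _)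
    #fat≤6 cover t t~fat ta td (t∉A ∷ t∉B ∷ t∉C ∷ _)
    with x , px , tx ← incomplete _ t t∉B
       | w , pw , tw ← incomplete _ t t∉C
    with ax ∷ cx ∷ dx ∷ [] ← avoid⇒≁ (a ∷ c ∷ d ∷ []) px
    with y , py , ty , xy ← far-exclusive I t x w cx pw tw
    with ay ∷ by ∷ dy ∷ [] ← avoid⇒≁ (a ∷ b ∷ d ∷ []) py
    = λ v fv → exclusive-clique K (filled a (in-own-cluster I) ta) (filled′ v fv)
    where
    K : Coclique (d ∷ x ∷ y ∷ [])
    K = (dx ∷ dy ∷ []) ∷ (xy ∷ []) ∷ [] ∷ []
    Kt : Coclique (t ∷ d ∷ x ∷ y ∷ [])
    Kt = (td ∷ tx ∷ ty ∷ []) ∷ K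
    P : V → Bool
    P = avoid (d ∷ x ∷ y ∷ [])
    P⇒near : ∀ v → (P v ⇒ t ~ v) ≡ true
    P⇒near v = ⇒-intro (exclusive-clique K (≁⇒avoid (≁-sym td ∷ ≁-sym tx ∷ ≁-sym ty ∷ [])))
    -- A vertex of `P` misses `x`, `y` and `d`, which are seen only by `b`, only by `c` and only by
    -- `d`. It is therefore outside those three clusters, and `cover` leaves only `fat` or the
    -- cluster of `a`.
    P⇒covered : ∀ v → (P v ⇒ fat v ∨ ℓ b c d v) ≡ true
    P⇒covered v = ⇒-intro λ Pv → covered′ (avoid⇒≁ (d ∷ x ∷ y ∷ []) Pv)
      where
      covered′ : All (_≁ v) (d ∷ x ∷ y ∷ []) → fat v ∨ ℓ b c d v ≡ true
      covered′ (dv ∷ xv ∷ yv ∷ []) with dichotomy (fat v ∨ ℓ b c d v)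
      ... | inj₁ fA = fA
      ... | inj₂ ¬fA = ⊥-elim (cover v (entails not-or (λ f A → not f) refl (fat v ∷ ℓ b c d v ∷ []) (¬fA ∷ []))
        (entails not-or (λ f A → not A) refl (fat v ∷ ℓ b c d v ∷ []) (¬fA ∷ []) ∷
         outside-cluster _ x px xv ∷ outside-cluster _ y py yv ∷
         outside-cluster _ d (≁⇒avoid (ad ∷ bd ∷ cd ∷ [])) dv ∷ []))
        where
        not-or : List (Formula 2)
        not-or = (λ f A → not (f ∨ A)) ∷ []
    tight : ∀ v → (t ~ v ∧ (fat v ∨ ℓ b c d v) ⇒ P v) ≡ true
    tight = count-tight ((λ p t f A → p ⇒ t) ∷ (λ p t f A → p ⇒ f ∨ A) ∷ [])
      ((λ p t f A → p) ∷ []) ((λ p t f A → t ∧ f) ∷ (λ p t f A → t ∧ A) ∷ [])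
      (P ∷ (t ~_) ∷ fat ∷ ℓ b c d ∷ []) (λ v → P⇒near v ∷ P⇒covered v ∷ [])
      (λ p t f A → t ∧ (f ∨ A) ⇒ p) refl refl
      (≤-trans (+-mono-≤ (≤-trans (#-mono λ v p → ∧-trueʳ {t ~ v} p) #fat≤6)
                         (+-monoˡ-≤ 0 (common-cluster-≤5 _ t t∉A)))
               (+-monoˡ-≤ 0 (exclusive-≥11 Kt)))
    filled : ∀ v → ℓ b c d v ≡ true → t ~ v ≡ true → P v ≡ true
    filled v Av tv = entails {k = 4}
      ((λ p t f A → t ∧ (f ∨ A) ⇒ p) ∷ (λ p t f A → A) ∷ (λ p t f A → t) ∷ []) (λ p t f A → p) refl
      (P v ∷ t ~ v ∷ fat v ∷ ℓ b c d v ∷ []) (tight v ∷ Av ∷ tv ∷ [])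
    filled′ : ∀ v → fat v ≡ true → P v ≡ true
    filled′ v fv = entails {k = 4}
      ((λ p t f A → t ∧ (f ∨ A) ⇒ p) ∷ (λ p t f A → f) ∷ (λ p t f A → t) ∷ []) (λ p t f A → p) refl
      (P v ∷ t ~ v ∷ fat v ∷ ℓ b c d v ∷ []) (tight v ∷ fv ∷ t~fat v fv ∷ [])

  -- Bundled so that a permutation of the centres acts on all three facts at once, while `fat` stays
  -- literally the same predicate.
  record Exception (fat : V → Bool) (t a b c d : V) : Set where
    field
      coclique    : Coclique (a ∷ b ∷ c ∷ d ∷ [])
      cover       : ∀ v → not (fat v) ≡ true → ¬ Unclustered a b c d v
      unclustered : Unclustered a b c d t

  exception₁₂ : ∀ {fat t} → Exception fat t a b c d → Exception fat t b a c d
  exception₁₂ {a} {b} {c} {d} E = record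
    { coclique    = swap₁₂ coclique
    ; cover       = λ v ¬fv → cover v ¬fv ∘ unclustered₁₂ b a c d
    ; unclustered = unclustered₁₂ a b c d unclustered }
    where open Exception E

  exception₂₃ : ∀ {fat t} → Exception fat t a b c d → Exception fat t a c b d
  exception₂₃ {a} {b} {c} {d} E = record
    { coclique    = swap₂₃ coclique
    ; cover       = λ v ¬fv → cover v ¬fv ∘ unclustered₂₃ a c b d
    ; unclustered = unclustered₂₃ a b c d unclustered }
    where open Exception E

  exception₃₄ : ∀ {fat t} → Exception fat t a b c d → Exception fat t a b d c
  exception₃₄ {a} {b} {c} {d} E = record
    { coclique    = swap₃₄ coclique
    ; cover       = λ v ¬fv → cover v ¬fv ∘ unclustered₃₄ a b d c
    ; unclustered = unclustered₃₄ a b c d unclustered }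
    where open Exception E

  -- Applying `centre-dominates` to `a` and, after an exchange, to `b` makes the six vertices of
  -- `fat` common neighbours of the nonadjacent `a` and `b`.
  no-exception : ∀ {fat t} → Exception fat t a b c d → # fat ≡ 6 → (∀ v → fat v ≡ true → t ~ v ≡ true) →
                 t ~ a ≡ true → t ~ b ≡ true → t ≁ d → ⊥
  no-exception {a} {b} {fat = fat} {t} E #fat≡6 t~fat ta tb td =
    contradict coclique
    where
    open Exception E
    a~fat : ∀ v → fat v ≡ true → a ~ v ≡ true
    a~fat = centre-dominates coclique (≤-reflexive #fat≡6) cover t t~fat ta td unclustered
    b~fat : ∀ v → fat v ≡ true → b ~ v ≡ true
    b~fat = centre-dominates (swap₁₂ coclique) (≤-reflexive #fat≡6)
      (Exception.cover (exception₁₂ E)) t t~fat tb td (Exception.unclustered (exception₁₂ E))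
    contradict : Coclique (a ∷ b ∷ cs) → ⊥
    contradict ((ab ∷ _) ∷ _) = ≤⇒≤ᵇ {6} {5}
      (≤-trans (≤-reflexive (sym #fat≡6)) (≤-trans (#-mono λ v fv → ∧-true (a~fat v fv) (b~fat v fv)) (common ab)))

  -- This is `attached` read contrapositively.
  pair-near : ∀ {fat v} → Exception fat v a b c d → not (avoid (c ∷ d ∷ []) v) ≡ true
  pair-near {c = c} {d} {v = v} E with dichotomy (avoid (c ∷ d ∷ []) v) | Exception.unclustered E
  ... | inj₂ near | _ = near
  ... | inj₁ away | v∉A ∷ v∉B ∷ _ with attached (Exception.coclique E) v away
  ...   | inj₁ v∈A = contradictory (complete-complete _ v v∈A) v∉A
  ...   | inj₂ v∈B = contradictory (complete-complete _ v v∈B) v∉B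

  adjacencies : Formula 4 → ∀ a b c d → V → Bool
  adjacencies φ a b c d v = φ ⟨ at ((a ~_) ∷ (b ~_) ∷ (c ~_) ∷ (d ~_) ∷ []) v ⟩

  always : Formula 4
  always a b c d = a ∧ (b ∧ (c ∧ d))

  -- By `pair-near` an unclustered vertex has a neighbour in each of the six pairs of centres, so it
  -- misses at most one centre.
  thin-clustered : Coclique (a ∷ b ∷ c ∷ d ∷ []) → ∀ v →
    not (adjacencies at-least-three a b c d v) ≡ true → ¬ Unclustered a b c d v
  thin-clustered {a} {b} {c} {d} I v thin U = contradictory
    (entails {k = 4}
      ((λ a b c d → not (none (c ∷ d ∷ []))) ∷ (λ a b c d → not (none (b ∷ d ∷ []))) ∷
       (λ a b c d → not (none (b ∷ c ∷ []))) ∷ (λ a b c d → not (none (a ∷ d ∷ []))) ∷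
       (λ a b c d → not (none (a ∷ c ∷ []))) ∷ (λ a b c d → not (none (a ∷ b ∷ []))) ∷ [])
      at-least-three refl (a ~ v ∷ b ~ v ∷ c ~ v ∷ d ~ v ∷ [])
      (pair-near E ∷ pair-near (exception₂₃ E) ∷ pair-near (exception₂₃ (exception₃₄ E)) ∷
       pair-near (exception₂₃ (exception₁₂ E)) ∷ pair-near (exception₂₃ (exception₁₂ (exception₃₄ E))) ∷
       pair-near (exception₂₃ (exception₃₄ (exception₁₂ (exception₂₃ E)))) ∷ []))
    thin
    where
    -- pair-near does not depend on fat, so the choice making `cover` vacuous will do.
    E : Exception (λ _ → true) v a b c d
    E = record { coclique = I ; cover = λ _ () ; unclustered = U }

  #-thrice : Coclique (a ∷ b ∷ c ∷ d ∷ []) →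
    # (adjacencies at-least-three a b c d) + (# (adjacencies always a b c d) + # (adjacencies always a b c d)) ≤ 6
  #-thrice {a} {b} {c} {d} I@((ab ∷ ac ∷ ad ∷ []) ∷ (bc ∷ bd ∷ []) ∷ (cd ∷ []) ∷ _) =
    counts {# (adjacencies at-least-three a b c d)} {# (adjacencies always a b c d)}
      (degree a) (degree b) (degree c) (degree d) #V
      (common ab) (common ac) (common ad) (common bc) (common bd) (common cd)
      -- If s centres are equal or adjacent to a vertex, then s + [s ≥ 3] + 2 [s = 4] ≤ 1 + s (s -
      -- 1) / 2. In the sum the left side contains 4 · 26 = 104, and the right side is at most 80 +
      -- 6 · 5 = 110.
      (count-≤ ((λ a b c d → not (none (a ∷ b ∷ c ∷ d ∷ []))) ∷ [])
        ((λ a b c d → a) ∷ (λ a b c d → b) ∷ (λ a b c d → c) ∷ (λ a b c d → d) ∷ at-least-three ∷ always ∷ always ∷ [])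
        ((λ a b c d → true) ∷ (λ a b c d → a ∧ b) ∷ (λ a b c d → a ∧ c) ∷ (λ a b c d → a ∧ d) ∷
         (λ a b c d → b ∧ c) ∷ (λ a b c d → b ∧ d) ∷ (λ a b c d → c ∧ d) ∷ [])
        ((a ~_) ∷ (b ~_) ∷ (c ~_) ∷ (d ~_) ∷ []) (λ v → maximal I v ∷ []) refl)
    where
    counts : ∀ {x y a b c d t ab ac ad bc bd cd} → a ≡ 26 → b ≡ 26 → c ≡ 26 → d ≡ 26 → t ≡ 80 →
             ab ≤ 5 → ac ≤ 5 → ad ≤ 5 → bc ≤ 5 → bd ≤ 5 → cd ≤ 5 →
             a + (b + (c + (d + (x + (y + (y + 0)))))) ≤ t + (ab + (ac + (ad + (bc + (bd + (cd + 0)))))) → x + (y + y) ≤ 6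
    counts {x} {y} refl refl refl refl refl ab ac ad bc bd cd le rewrite +-identityʳ y =
      +-cancelˡ-≤ 104 (x + (y + y)) 6 (≤-trans le (+-monoʳ-≤ 80
        (+-mono-≤ ab (+-mono-≤ ac (+-mono-≤ ad (+-mono-≤ bc (+-mono-≤ bd (+-monoˡ-≤ 0 cd))))))))

  #-near-thrice : Coclique (a ∷ b ∷ c ∷ d ∷ []) → ∀ t → Unclustered a b c d t →
    6 ≤ # (λ v → t ~ v ∧ adjacencies at-least-three a b c d v)
  #-near-thrice {a} {b} {c} {d} I t (t∉A ∷ t∉B ∷ t∉C ∷ t∉D ∷ []) =
    -- By `thin-clustered` the remaining neighbours of `t` lie in clusters, at most 5 in each: 26 -
    -- 4 · 5 = 6.
    counts {# (λ v → t ~ v ∧ adjacencies at-least-three a b c d v)} (degree t)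
      (common-cluster-≤5 _ t t∉A) (common-cluster-≤5 _ t t∉B) (common-cluster-≤5 _ t t∉C) (common-cluster-≤5 _ t t∉D)
      (count-≤ ((λ t f A B C D → f ∨ (A ∨ (B ∨ (C ∨ D)))) ∷ [])
        ((λ t f A B C D → t) ∷ [])
        ((λ t f A B C D → t ∧ f) ∷ (λ t f A B C D → t ∧ A) ∷ (λ t f A B C D → t ∧ B) ∷
         (λ t f A B C D → t ∧ C) ∷ (λ t f A B C D → t ∧ D) ∷ [])
        ((t ~_) ∷ adjacencies at-least-three a b c d ∷ ℓ b c d ∷ ℓ a c d ∷ ℓ a b d ∷ ℓ a b c ∷ [])
        (λ v → some v ∷ []) refl)
    where
    some : ∀ v → adjacencies at-least-three a b c d v ∨ (ℓ b c d v ∨ (ℓ a c d v ∨ (ℓ a b d v ∨ ℓ a b c v))) ≡ true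
    some v with dichotomy (adjacencies at-least-three a b c d v ∨ (ℓ b c d v ∨ (ℓ a c d v ∨ (ℓ a b d v ∨ ℓ a b c v))))
    ... | inj₁ cov = cov
    ... | inj₂ ¬cov = ⊥-elim (thin-clustered I v (excl (λ f A B C D → not f) refl)
            (excl (λ f A B C D → not A) refl ∷ excl (λ f A B C D → not B) refl ∷
             excl (λ f A B C D → not C) refl ∷ excl (λ f A B C D → not D) refl ∷ []))
      where
      bs : Vec Bool 5
      bs = adjacencies at-least-three a b c d v ∷ ℓ b c d v ∷ ℓ a c d v ∷ ℓ a b d v ∷ ℓ a b c v ∷ []
      excl : (φ : Formula 5) → valid 5 (λ bs → ⋀ ((λ f A B C D → not (f ∨ (A ∨ (B ∨ (C ∨ D))))) ∷ []) bs ⇒ φ ⟨ bs ⟩) ≡ true →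
             φ ⟨ bs ⟩ ≡ true
      excl φ ok = entails ((λ f A B C D → not (f ∨ (A ∨ (B ∨ (C ∨ D))))) ∷ []) φ ok bs (¬cov ∷ [])
    counts : ∀ {x t A B C D} → t ≡ 26 → A ≤ 5 → B ≤ 5 → C ≤ 5 → D ≤ 5 →
             t + 0 ≤ x + (A + (B + (C + (D + 0)))) → 6 ≤ x
    counts {x} refl A B C D le = +-cancelʳ-≤ 20 6 x (≤-trans le
      (+-monoʳ-≤ x (+-mono-≤ A (+-mono-≤ B (+-mono-≤ C (+-monoˡ-≤ 0 D))))))

  -- The lower and upper bounds 6 meet: exactly six vertices have at least three neighbours among
  -- the centres, `t` is adjacent to all six, and no vertex is adjacent to all four centres. As one
  -- of the six, `t` misses exactly one centre, and `no-exception` applies with that centre moved to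
  -- the last place.
  clustered : Coclique (a ∷ b ∷ c ∷ d ∷ []) → ∀ v → ¬ Unclustered a b c d v
  clustered {a} {b} {c} {d} I t U = cases (dichotomy (d ~ t)) (dichotomy (c ~ t)) (dichotomy (b ~ t)) (dichotomy (a ~ t))
    where
    fat : V → Bool
    fat = adjacencies at-least-three a b c d
    E : Exception fat t a b c d
    E = record { coclique = I ; cover = thin-clustered I ; unclustered = U }
    #near≤#fat : # (λ v → t ~ v ∧ fat v) ≤ # fat
    #near≤#fat = #-mono λ v p → ∧-trueʳ {t ~ v} p
    6≤#fat : 6 ≤ # fat
    6≤#fat = ≤-trans (#-near-thrice I t U) #near≤#fat
    #always : ℕ
    #always = # (adjacencies always a b c d)
    few : # fat + (#always + #always) ≤ 6
    few = #-thrice I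
    #fat≡6 : # fat ≡ 6
    #fat≡6 = ≤-antisym (≤-trans (m≤m+n (# fat) (#always + #always)) few) 6≤#fat
    t~fat : ∀ v → fat v ≡ true → t ~ v ≡ true
    t~fat v = ⇒-elim {fat v} {t ~ v} (count-tight [] ((λ t f → t ∧ f) ∷ []) ((λ t f → f) ∷ []) ((t ~_) ∷ fat ∷ []) (λ _ → [])
      (λ t f → f ⇒ t) refl refl
      (+-monoˡ-≤ 0 (≤-trans (≤-reflexive #fat≡6) (#-near-thrice I t U))) v)
    #always≡0 : #always ≤ 0
    #always≡0 = ≤-trans (m≤m+n #always #always)
      (+-cancelˡ-≤ 6 (#always + #always) 0 (≤-trans (+-monoˡ-≤ (#always + #always) 6≤#fat) few))
    not-always : not (adjacencies always a b c d t) ≡ true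
    -- The empty left side has total 0, so tightness turns a count of 0 into absence at every
    -- vertex.
    not-always = count-tight [] [] ((λ a → a) ∷ []) (adjacencies always a b c d ∷ []) (λ _ → []) (λ a → not a) refl refl
      (+-monoˡ-≤ 0 #always≡0) t
    fat-t : fat t ≡ true
    fat-t with dichotomy (fat t)
    ... | inj₁ yes-fat = yes-fat
    ... | inj₂ thin = ⊥-elim (thin-clustered I t thin U)
    near : (φ : Formula 4) → not (φ ⟨ a ~ t ∷ b ~ t ∷ c ~ t ∷ d ~ t ∷ [] ⟩) ≡ true → (ψ : Formula 4) →
           valid 4 (λ bs → ⋀ (at-least-three ∷ (λ a b c d → not (always a b c d)) ∷ (λ a b c d → not (φ a b c d)) ∷ []) bs ⇒ ψ ⟨ bs ⟩) ≡ true →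
           ψ ⟨ a ~ t ∷ b ~ t ∷ c ~ t ∷ d ~ t ∷ [] ⟩ ≡ true
    near φ far ψ ok = entails (at-least-three ∷ (λ a b c d → not (always a b c d)) ∷ (λ a b c d → not (φ a b c d)) ∷ []) ψ ok
      (a ~ t ∷ b ~ t ∷ c ~ t ∷ d ~ t ∷ []) (fat-t ∷ not-always ∷ far ∷ [])
    cases : d ~ t ≡ true ⊎ d ≁ t → c ~ t ≡ true ⊎ c ≁ t → b ~ t ≡ true ⊎ b ≁ t → a ~ t ≡ true ⊎ a ≁ t → ⊥
    cases (inj₂ dt) _ _ _ = no-exception E #fat≡6 t~fat
      (~-flip (near (λ a b c d → d) dt (λ a b c d → a) refl)) (~-flip (near (λ a b c d → d) dt (λ a b c d → b) refl)) (≁-sym dt)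
    cases _ (inj₂ ct) _ _ = no-exception (exception₃₄ E) #fat≡6 t~fat
      (~-flip (near (λ a b c d → c) ct (λ a b c d → a) refl)) (~-flip (near (λ a b c d → c) ct (λ a b c d → b) refl)) (≁-sym ct)
    cases _ _ (inj₂ bt) _ = no-exception (exception₃₄ (exception₂₃ E)) #fat≡6 t~fat
      (~-flip (near (λ a b c d → b) bt (λ a b c d → a) refl)) (~-flip (near (λ a b c d → b) bt (λ a b c d → c) refl)) (≁-sym bt)
    cases _ _ _ (inj₂ at′) = no-exception (exception₃₄ (exception₂₃ (exception₁₂ E))) #fat≡6 t~fat
      (~-flip (near (λ a b c d → a) at′ (λ a b c d → b) refl)) (~-flip (near (λ a b c d → a) at′ (λ a b c d → c) refl)) (≁-sym at′)
    cases (inj₁ dt) (inj₁ ct) (inj₁ bt) (inj₁ at′) =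
      contradictory (∧-true at′ (∧-true bt (∧-true ct dt))) not-always

  -- Partition into four cliques

  FourCliques : Set
  FourCliques = ∃ λ (C : Fin 4 → V → Bool) →
    (∀ i → (∀ u v → C i u ≡ true → C i v ≡ true → u ~ v ≡ true) × # (C i) ≡ 20) ×
    (∀ i j → i ≢ j → ∀ v → C i v ≡ true → C j v ≡ true → ⊥)

  cliques : Coclique (a ∷ b ∷ c ∷ d ∷ []) → FourCliques
  cliques {a} {b} {c} {d} I = C , (λ i → C-clique i , C-size i) , C-disjoint
    where
    clusters : Vec (V → Bool) 4
    clusters = ℓ b c d ∷ ℓ a c d ∷ ℓ a b d ∷ ℓ a b c ∷ []

    C : Fin 4 → V → Bool
    C i v = Vec.lookup (at clusters v) i

    C-clique : ∀ i u v → C i u ≡ true → C i v ≡ true → u ~ v ≡ true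
    C-clique 0F = cluster-clique I
    C-clique 1F = cluster-clique (swap₁₂ I)
    C-clique 2F = cluster-clique (swap₁₂ (swap₂₃ I))
    C-clique 3F = cluster-clique (swap₁₂ (swap₂₃ (swap₃₄ I)))

    cover : ∀ v → ℓ b c d v ∨ (ℓ a c d v ∨ (ℓ a b d v ∨ ℓ a b c v)) ≡ true
    cover v with dichotomy (ℓ b c d v ∨ (ℓ a c d v ∨ (ℓ a b d v ∨ ℓ a b c v)))
    ... | inj₁ cov = cov
    ... | inj₂ ¬cov = ⊥-elim (clustered I v
            (excl (λ A B C D → not A) refl ∷ excl (λ A B C D → not B) refl ∷
             excl (λ A B C D → not C) refl ∷ excl (λ A B C D → not D) refl ∷ []))
      where
      hs : List (Formula 4)
      hs = (λ A B C D → not (A ∨ (B ∨ (C ∨ D)))) ∷ []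
      excl : (φ : Formula 4) → valid 4 (λ bs → ⋀ hs bs ⇒ φ ⟨ bs ⟩) ≡ true → φ ⟨ at clusters v ⟩ ≡ true
      excl φ ok = entails hs φ ok (at clusters v) (¬cov ∷ [])

    members : List (Formula 4)
    members = (λ A B C D → A) ∷ (λ A B C D → B) ∷ (λ A B C D → C) ∷ (λ A B C D → D) ∷ []

    -- The clusters cover 80 vertices with at most 20 each, so all four bounds are attained.
    sizes : All (_≡ 20) (# (C 0F) ∷ # (C 1F) ∷ # (C 2F) ∷ # (C 3F) ∷ [])
    sizes = all-tight _
      (clique≤20 (C 0F) (C-clique 0F) ∷ clique≤20 (C 1F) (C-clique 1F) ∷
       clique≤20 (C 2F) (C-clique 2F) ∷ clique≤20 (C 3F) (C-clique 3F) ∷ [])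
      (subst (_≤ total members clusters) (trans (+-identityʳ _) #V)
        (count-≤ ((λ A B C D → A ∨ (B ∨ (C ∨ D))) ∷ []) ((λ A B C D → true) ∷ []) members clusters
          (λ v → cover v ∷ []) refl))

    C-size : ∀ i → # (C i) ≡ 20
    C-size i = go i sizes
      where
      go : ∀ i → All (_≡ 20) (# (C 0F) ∷ # (C 1F) ∷ # (C 2F) ∷ # (C 3F) ∷ []) → # (C i) ≡ 20
      go 0F (p ∷ _)             = p
      go 1F (_ ∷ p ∷ _)         = p
      go 2F (_ ∷ _ ∷ p ∷ _)     = p
      go 3F (_ ∷ _ ∷ _ ∷ p ∷ _) = p

    -- The sizes now add up to 80, so the covering inequality is tight and no vertex is counted
    -- twice.
    exactly-once : ∀ v → exactly-one ⟨ at clusters v ⟩ ≡ true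
    exactly-once = count-tight ((λ A B C D → A ∨ (B ∨ (C ∨ D))) ∷ []) ((λ A B C D → true) ∷ []) members clusters
      (λ v → cover v ∷ []) exactly-one refl refl
      (≤-reflexive (trans (cong₂ _+_ (C-size 0F) (cong₂ _+_ (C-size 1F) (cong₂ _+_ (C-size 2F) (cong (_+ 0) (C-size 3F)))))
        (sym (trans (+-identityʳ _) #V))))

    C-disjoint : ∀ i j → i ≢ j → ∀ v → C i v ≡ true → C j v ≡ true → ⊥
    C-disjoint i j i≢j v Ci Cj = contradictory
      (⇒-elim (valid-sound (share i j) (share-valid i j) (at clusters v)) (∧-true (exactly-once v) (∧-true Ci Cj)))
      (cong not (dec-false (i ≟ᶠ j) i≢j))
      where
      share : ∀ i j → Vec Bool 4 → Bool
      share i j bs = exactly-one ⟨ bs ⟩ ∧ (Vec.lookup bs i ∧ Vec.lookup bs j) ⇒ does (i ≟ᶠ j)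
      share-valid : ∀ i j → valid 4 (share i j) ≡ true
      share-valid = toWitness {a? = all? λ i → all? λ j → valid 4 (share i j) Bool.≟ true} _

  four-cliques : FourCliques
  four-cliques = let a , b , c , d , I = coclique₄ in cliques I

-- Truth tables and subsets

∣S∣≡# : (S : Subset n) → ∣ S ∣ ≡ # (Vec.lookup S)
∣S∣≡# []            = refl
∣S∣≡# (inside  ∷ S) = cong suc (∣S∣≡# S)
∣S∣≡# (outside ∷ S) = ∣S∣≡# S

bool-cong : ∀ {b c} → (b ≡ true → c ≡ true) → (c ≡ true → b ≡ true) → b ≡ c
bool-cong {true}  {c}     f g = sym (f refl)
bool-cong {false} {true}  f g = g refl
bool-cong {false} {false} f g = refl

#-HasSize : ∀ {P : Fin n → Set} {k} → HasSize P k → (p : Fin n → Bool) →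
            (∀ z → p z ≡ true → P z) → (∀ z → P z → p z ≡ true) → # p ≡ k
#-HasSize (S , S⇔P , ∣S∣≡k) p p⇒P P⇒p = trans
  (sum-cong-≗ λ z → cong ⟦_⟧ (bool-cong
    (λ pz → []=⇒lookup (Equivalence.from (S⇔P z) (p⇒P z pz)))
    (λ Sz → P⇒p z (Equivalence.to (S⇔P z) (lookup⇒[]= z S Sz)))))
  (trans (sym (∣S∣≡# S)) ∣S∣≡k)

does-true : ∀ {P : Set} (P? : Dec P) → does P? ≡ true → P
does-true (yes p) _ = p

-- Distances and intersection numbers

module Distances (Γ : Graph) where
  open Graph Γ using (Adj; adj?; adj-sym; adj-irr)

  private variable
    x y z : Vertex Γ
    l : ℕ

  walk? : ∀ x y k → Dec (Walk Γ x y k)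
  walk? x y zero    = map′ (λ { refl → [] }) (λ { [] → refl }) (x ≟ᶠ y)
  walk? x y (suc k) = map′ (λ { (z , a , w) → a ∷ w }) (λ { (a ∷ w) → _ , a , w })
                        (any? λ z → adj? x z ×-dec walk? z y k)

  snoc : Walk Γ x y k → Adj y z → Walk Γ x z (suc k)
  snoc []      a = a ∷ []
  snoc (b ∷ w) a = b ∷ snoc w a

  reverse : Walk Γ x y k → Walk Γ y x k
  reverse []      = []
  reverse (a ∷ w) = snoc (reverse w) (adj-sym a)

  shortest : ∀ x y k → (∃ λ d → Distance Γ x y d) ⊎ (∀ {l} → l < k → ¬ Walk Γ x y l)
  shortest x y zero = inj₂ λ ()
  shortest x y (suc k) with shortest x y k | walk? x y k
  ... | inj₁ found | _     = inj₁ found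
  ... | inj₂ none  | yes w = inj₁ (k , w , λ v → ≮⇒≥ λ l<k → none l<k v)
  ... | inj₂ none  | no ¬w = inj₂ λ { {l} (s≤s l≤k) v → case-≤ l≤k v }
    where
    case-≤ : ∀ {l} → l ≤ k → ¬ Walk Γ x y l
    case-≤ l≤k v with m≤n⇒m<n∨m≡n l≤k
    ... | inj₁ l<k  = none l<k v
    ... | inj₂ refl = ¬w v

  distance : Connected Γ → ∀ x y → ∃ λ d → Distance Γ x y d
  -- The bound is `suc k` so that the length `k` of the given walk is itself searched.
  distance connected x y with k , w ← connected x y with shortest x y (suc k)
  ... | inj₁ found = found
  ... | inj₂ none  = ⊥-elim (none ≤-refl w)

  Distance-unique : Distance Γ x y k → Distance Γ x y l → k ≡ l
  Distance-unique (v , v-min) (w , w-min) = ≤-antisym (v-min w) (w-min v)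

  Distance-sym : Distance Γ x y k → Distance Γ y x k
  Distance-sym (w , w-min) = reverse w , λ v → w-min (reverse v)

  Distance-snoc : Distance Γ x y k → Distance Γ x z l → Adj y z → l ≤ suc k
  Distance-snoc (w , _) (_ , v-min) a = v-min (snoc w a)

module Intersection (Γ : Graph) (regular : IsDistanceRegular Γ (80 ∷ 54 ∷ 12 ∷ []) (1 ∷ 6 ∷ 60 ∷ [])) where
  open Graph Γ using (Adj; adj-irr)
  open IsDistanceRegular regular
  open Distances Γ

  V : Set
  V = Vertex Γ

  d-≤3 : ∀ x y → proj₁ (distance connected x y) < 4
  d-≤3 x y = s≤s (proj₁ diameter (proj₂ (distance connected x y)))

  -- Distances are handled only through `d-Distance`; unfolding `d` would expose the search for
  -- walks.
  opaque
    d : V → V → Fin 4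
    d x y = fromℕ< (d-≤3 x y)

    d-Distance : ∀ x y → Distance Γ x y (toℕ (d x y))
    d-Distance x y = subst (Distance Γ x y) (sym (toℕ-fromℕ< (d-≤3 x y))) (proj₂ (distance connected x y))

  private variable
    x y z : V
    i j : Fin 4

  Distance⇒d : Distance Γ x y (toℕ i) → d x y ≡ i
  Distance⇒d dist = toℕ-injective (Distance-unique (d-Distance _ _) dist)

  d⇒Distance : d x y ≡ i → Distance Γ x y (toℕ i)
  d⇒Distance {x} {y} refl = d-Distance x y

  d-sym : ∀ x y → d x y ≡ d y x
  d-sym x y = Distance⇒d (Distance-sym (d-Distance y x))

  d-refl : ∀ x → d x x ≡ 0F
  d-refl x = Distance⇒d ([] , λ _ → z≤n)

  d≡0⇒≡ : d x y ≡ 0F → x ≡ y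
  d≡0⇒≡ p with [] ← proj₁ (d⇒Distance p) = refl

  d≡1⇒Adj : d x y ≡ 1F → Adj x y
  d≡1⇒Adj p with a ∷ [] ← proj₁ (d⇒Distance p) = a

  Adj⇒d≡1 : Adj x y → d x y ≡ 1F
  Adj⇒d≡1 {x} {y} a = Distance⇒d (a ∷ [] , minimal)
    where
    minimal : ∀ {k} → Walk Γ x y k → 1 ≤ k
    minimal []      = ⊥-elim (adj-irr refl a)
    minimal (_ ∷ _) = s≤s z≤n

  d-triangle : ∀ x → d y z ≡ 1F → toℕ (d x z) ≤ suc (toℕ (d x y))
  d-triangle x yz = Distance-snoc (d-Distance x _) (d-Distance x _) (d≡1⇒Adj yz)

  δ : Fin 4 → V → V → Bool
  δ i x y = does (d x y ≟ᶠ i)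

  δ-true : d x y ≡ i → δ i x y ≡ true
  δ-true {x} {y} {i} = dec-true (d x y ≟ᶠ i)

  δ⇒≡ : δ i x y ≡ true → d x y ≡ i
  δ⇒≡ {i} {x} {y} = does-true (d x y ≟ᶠ i)

  δ-sym : ∀ i x y → δ i x y ≡ δ i y x
  δ-sym i x y = cong (λ k → does (k ≟ᶠ i)) (d-sym x y)

  degree : ∀ x → # (δ 1F x) ≡ 80
  degree x = #-HasSize (b-count 0F (d⇒Distance (d-refl x))) (δ 1F x)
    (λ z p → d≡1⇒Adj (δ⇒≡ p) , d⇒Distance (δ⇒≡ p)) (λ z → δ-true ∘ Distance⇒d ∘ proj₂)

  b₁ : d x y ≡ 1F → # (λ z → δ 1F y z ∧ δ 2F x z) ≡ 54
  b₁ {x} {y} xy = #-HasSize (b-count 1F (d⇒Distance xy)) _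
    (λ z p → d≡1⇒Adj (δ⇒≡ (∧-trueˡ p)) , d⇒Distance (δ⇒≡ (∧-trueʳ {δ 1F y z} p)))
    (λ z (a , dist) → ∧-true (δ-true (Adj⇒d≡1 a)) (δ-true (Distance⇒d dist)))

  b₂ : d x y ≡ 2F → # (λ z → δ 1F y z ∧ δ 3F x z) ≡ 12
  b₂ {x} {y} xy = #-HasSize (b-count 2F (d⇒Distance xy)) _
    (λ z p → d≡1⇒Adj (δ⇒≡ (∧-trueˡ p)) , d⇒Distance (δ⇒≡ (∧-trueʳ {δ 1F y z} p)))
    (λ z (a , dist) → ∧-true (δ-true (Adj⇒d≡1 a)) (δ-true (Distance⇒d dist)))

  c₁ : d x y ≡ 1F → # (λ z → δ 1F y z ∧ δ 0F x z) ≡ 1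
  c₁ {x} {y} xy = #-HasSize (c-count 1F (d⇒Distance xy)) _
    (λ z p → d≡1⇒Adj (δ⇒≡ (∧-trueˡ p)) , 0 , refl , d⇒Distance (δ⇒≡ (∧-trueʳ {δ 1F y z} p)))
    (λ { z (a , _ , refl , dist) → ∧-true (δ-true (Adj⇒d≡1 a)) (δ-true (Distance⇒d dist)) })

  c₂ : d x y ≡ 2F → # (λ z → δ 1F y z ∧ δ 1F x z) ≡ 6
  c₂ {x} {y} xy = #-HasSize (c-count 2F (d⇒Distance xy)) _
    (λ z p → d≡1⇒Adj (δ⇒≡ (∧-trueˡ p)) , 1 , refl , d⇒Distance (δ⇒≡ (∧-trueʳ {δ 1F y z} p)))
    (λ { z (a , _ , refl , dist) → ∧-true (δ-true (Adj⇒d≡1 a)) (δ-true (Distance⇒d dist)) })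

  c₃ : d x y ≡ 3F → # (λ z → δ 1F y z ∧ δ 2F x z) ≡ 60
  c₃ {x} {y} xy = #-HasSize (c-count 3F (d⇒Distance xy)) _
    (λ z p → d≡1⇒Adj (δ⇒≡ (∧-trueˡ p)) , 2 , refl , d⇒Distance (δ⇒≡ (∧-trueʳ {δ 1F y z} p)))
    (λ { z (a , _ , refl , dist) → ∧-true (δ-true (Adj⇒d≡1 a)) (δ-true (Distance⇒d dist)) })

  one-class : ∀ x y → exactly-one ⟨ δ 0F x y ∷ δ 1F x y ∷ δ 2F x y ∷ δ 3F x y ∷ [] ⟩ ≡ true
  one-class x y = go (d x y)
    where
    go : ∀ i → exactly-one ⟨ does (i ≟ᶠ 0F) ∷ does (i ≟ᶠ 1F) ∷ does (i ≟ᶠ 2F) ∷ does (i ≟ᶠ 3F) ∷ [] ⟩ ≡ true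
    go 0F = refl
    go 1F = refl
    go 2F = refl
    go 3F = refl

  too-far : d x y ≡ i → 2 + toℕ i ≤ toℕ j → d y z ≡ 1F → not (δ j x z) ≡ true
  too-far {x} {y} {i} {j} {z} xy i+2≤j yz with dichotomy (δ j x z)
  ... | inj₂ far = far
  ... | inj₁ xz = ⊥-elim (<⇒≱ i+2≤j (subst₂ (λ k l → toℕ k ≤ suc (toℕ l)) (δ⇒≡ xz) xy (d-triangle x yz)))

  too-near : d x y ≡ i → 2 + toℕ j ≤ toℕ i → d y z ≡ 1F → not (δ j x z) ≡ true
  too-near {x} {y} {i} {j} {z} xy j+2≤i yz with dichotomy (δ j x z)
  ... | inj₂ far = far
  ... | inj₁ xz = ⊥-elim (<⇒≱ j+2≤i (subst₂ (λ k l → toℕ k ≤ suc (toℕ l)) xy (δ⇒≡ xz)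
                    (d-triangle x (trans (d-sym z y) yz))))

  classes : V → V → Vec (V → Bool) 5
  classes x y = δ 1F y ∷ δ 0F x ∷ δ 1F x ∷ δ 2F x ∷ δ 3F x ∷ []

  -- A neighbour of `y` is at distance 0, 1 or 2 from `x`, so the intersection number is 80 - 1 -
  -- 54.
  a₁ : d x y ≡ 1F → # (λ z → δ 1F y z ∧ δ 1F x z) ≡ 25
  a₁ {x} {y} xy = +-cancelˡ-≡ 55 _ _ (counts (degree y) (c₁ xy) (b₁ xy)
    (count-≡ ((λ n → exactly-one) ∷ (λ n a b c d → n ⇒ not d) ∷ [])
      ((λ n a b c d → n) ∷ [])
      ((λ n a b c d → n ∧ a) ∷ (λ n a b c d → n ∧ c) ∷ (λ n a b c d → n ∧ b) ∷ [])
      (classes x y) (λ z → one-class x z ∷ ⇒-intro (λ yz → too-far xy (s≤s (s≤s (s≤s z≤n))) (δ⇒≡ yz)) ∷ []) refl))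
    where
    counts : ∀ {n c a b} → n ≡ 80 → c ≡ 1 → b ≡ 54 → n + 0 ≡ c + (b + (a + 0)) → 55 + a ≡ 80
    counts {a = a} refl refl refl eq rewrite +-identityʳ a = sym eq

  a₂ : d x y ≡ 2F → # (λ z → δ 1F y z ∧ δ 2F x z) ≡ 62
  a₂ {x} {y} xy = +-cancelˡ-≡ 18 _ _ (counts (degree y) (c₂ xy) (b₂ xy)
    (count-≡ ((λ n → exactly-one) ∷ (λ n a b c d → n ⇒ not a) ∷ [])
      ((λ n a b c d → n) ∷ [])
      ((λ n a b c d → n ∧ b) ∷ (λ n a b c d → n ∧ d) ∷ (λ n a b c d → n ∧ c) ∷ [])
      (classes x y) (λ z → one-class x z ∷ ⇒-intro (λ yz → too-near xy (s≤s (s≤s z≤n)) (δ⇒≡ yz)) ∷ []) refl))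
    where
    counts : ∀ {n c a b} → n ≡ 80 → c ≡ 6 → b ≡ 12 → n + 0 ≡ c + (b + (a + 0)) → 18 + a ≡ 80
    counts {a = a} refl refl refl eq rewrite +-identityʳ a = sym eq

  #-neighbours₁ : ∀ x y → # (λ z → δ 1F y z ∧ δ 1F x z) ≡ combination ((δ 0F x , 80) ∷ (δ 1F x , 25) ∷ (δ 2F x , 6) ∷ []) y
  #-neighbours₁ x y = go (d x y) refl
    where
    go : ∀ i → d x y ≡ i → # (λ z → δ 1F y z ∧ δ 1F x z) ≡
         ⟦ does (i ≟ᶠ 0F) ⟧ * 80 + (⟦ does (i ≟ᶠ 1F) ⟧ * 25 + (⟦ does (i ≟ᶠ 2F) ⟧ * 6 + 0))
    go 0F xy with refl ← d≡0⇒≡ xy = trans (sum-cong-≗ λ z → cong ⟦_⟧ (Bool.∧-idem (δ 1F x z))) (degree x)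
    go 1F xy = a₁ xy
    go 2F xy = c₂ xy
    go 3F xy = #-empty _ λ z → excluded z
      where
      excluded : ∀ z → not (δ 1F y z ∧ δ 1F x z) ≡ true
      excluded z = entails ((λ n b → n ⇒ not b) ∷ []) (λ n b → not (n ∧ b)) refl (δ 1F y z ∷ δ 1F x z ∷ [])
        (⇒-intro (λ yz → too-near xy (s≤s (s≤s (s≤s z≤n))) (δ⇒≡ yz)) ∷ [])

  #-neighbours₂ : ∀ x y → # (λ z → δ 1F y z ∧ δ 2F x z) ≡ combination ((δ 1F x , 54) ∷ (δ 2F x , 62) ∷ (δ 3F x , 60) ∷ []) y
  #-neighbours₂ x y = go (d x y) refl
    where
    go : ∀ i → d x y ≡ i → # (λ z → δ 1F y z ∧ δ 2F x z) ≡
         ⟦ does (i ≟ᶠ 1F) ⟧ * 54 + (⟦ does (i ≟ᶠ 2F) ⟧ * 62 + (⟦ does (i ≟ᶠ 3F) ⟧ * 60 + 0))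
    go 0F xy = #-empty _ λ z → excluded z
      where
      excluded : ∀ z → not (δ 1F y z ∧ δ 2F x z) ≡ true
      excluded z = entails ((λ n b → n ⇒ not b) ∷ []) (λ n b → not (n ∧ b)) refl (δ 1F y z ∷ δ 2F x z ∷ [])
        (⇒-intro (λ yz → too-far xy (s≤s (s≤s z≤n)) (δ⇒≡ yz)) ∷ [])
    go 1F xy = b₁ xy
    go 2F xy = a₂ xy
    go 3F xy = c₃ xy

  #-∧-comm : ∀ (p q : V → Bool) → # (λ v → p v ∧ q v) ≡ # (λ v → q v ∧ p v)
  #-∧-comm p q = sum-cong-≗ λ v → cong ⟦_⟧ (Bool.∧-comm (p v) (q v))

  #δ₀ : ∀ x → # (δ 0F x) ≡ 1
  #δ₀ x = trans (sum-cong-≗ λ y → trans (cong ⟦_⟧ (bool-cong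
      (λ xy → dec-true (x ≟ᶠ y) (d≡0⇒≡ (δ⇒≡ xy)))
      (λ x≡y → δ-true (subst (λ y → d x y ≡ 0F) (does-true (x ≟ᶠ y) x≡y) (d-refl x)))))
      (sym (*-identityˡ _)))
    (sum-delta (λ _ → 1) x)

  -- Counting the edges between distance classes 1 and 2 in two ways: 80 · 54 = 720 · 6.
  #δ₂ : ∀ x → # (δ 2F x) ≡ 720
  #δ₂ x = counts (degree x) (double-count (δ 1F x) (δ 2F x) (δ 1F)
    (λ z xz → b₁ {x} {z} (δ⇒≡ xz))
    (λ w xw → trans (sum-cong-≗ λ z → cong (λ b → ⟦ b ∧ δ 1F x z ⟧) (δ-sym 1F z w)) (c₂ {x} {w} (δ⇒≡ xw))))
    where
    counts : ∀ {a b} → a ≡ 80 → a * 54 ≡ b * 6 → b ≡ 720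
    counts {b = b} refl eq = *-cancelʳ-≡ b 720 6 (sym eq)

  #δ₃ : ∀ x → # (δ 3F x) ≡ 144
  #δ₃ x = counts (#δ₂ x) (double-count (δ 2F x) (δ 3F x) (δ 1F)
    (λ z xz → b₂ {x} {z} (δ⇒≡ xz))
    (λ w xw → trans (sum-cong-≗ λ z → cong (λ b → ⟦ b ∧ δ 2F x z ⟧) (δ-sym 1F z w)) (c₃ {x} {w} (δ⇒≡ xw))))
    where
    counts : ∀ {a b} → a ≡ 720 → a * 12 ≡ b * 60 → b ≡ 144
    counts {b = b} refl eq = *-cancelʳ-≡ b 144 60 (sym eq)

  -- Intersection numbers for adjacent vertices

  valency : Fin 4 → ℕ
  valency = Vec.lookup (1 ∷ 80 ∷ 720 ∷ 144 ∷ [])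

  #δ : ∀ i x → # (δ i x) ≡ valency i
  #δ 0F = #δ₀
  #δ 1F = degree
  #δ 2F = #δ₂
  #δ 3F = #δ₃

  -- The intersection numbers usually written p^1_ij; row `i` sums to `valency i`.
  p¹ : Fin 4 → Fin 4 → ℕ
  p¹ i j = Vec.lookup (Vec.lookup rows i) j
    where
    rows : Vec (Vec ℕ 4) 4
    rows = (0 ∷ 1  ∷ 0   ∷ 0   ∷ []) ∷
           (1 ∷ 25 ∷ 54  ∷ 0   ∷ []) ∷
           (0 ∷ 54 ∷ 558 ∷ 108 ∷ []) ∷
           (0 ∷ 0  ∷ 108 ∷ 36  ∷ []) ∷ []

  P : V → V → Fin 4 → Fin 4 → ℕ
  P x y i j = # (λ w → δ i x w ∧ δ j y w)

  P-sym : ∀ x y i j → P x y i j ≡ P y x j i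
  P-sym x y i j = #-∧-comm (δ i x) (δ j y)

  P-far : d x y ≡ 1F → 2 + toℕ i ≤ toℕ j → P x y i j ≡ 0
  P-far {x} {y} {i} {j} xy i+2≤j = #-empty _ λ w →
    entails ((λ p q → p ⇒ not q) ∷ []) (λ p q → not (p ∧ q)) refl (δ i x w ∷ δ j y w ∷ [])
      (⇒-intro (λ xw → trans (cong not (δ-sym j y w)) (too-far {w} {x} {i} {j} {y} (trans (d-sym w x) (δ⇒≡ xw)) i+2≤j xy)) ∷ [])

  P₀₀ : d x y ≡ 1F → P x y 0F 0F ≡ 0
  P₀₀ {x} {y} xy = #-empty _ λ w → entails ((λ p q → p ⇒ not q) ∷ []) (λ p q → not (p ∧ q)) refl (δ 0F x w ∷ δ 0F y w ∷ [])
      (⇒-intro (λ xw → apart w (d≡0⇒≡ (δ⇒≡ xw))) ∷ [])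
    where
    apart : ∀ w → x ≡ w → not (δ 0F y w) ≡ true
    apart w refl rewrite d-sym y x | xy = refl

  P₁₀ : d x y ≡ 1F → P x y 1F 0F ≡ 1
  P₁₀ {x} {y} xy = c₁ {y} {x} (trans (d-sym y x) xy)

  P₁₁ : d x y ≡ 1F → P x y 1F 1F ≡ 25
  P₁₁ {x} {y} xy = a₁ {y} {x} (trans (d-sym y x) xy)

  P₁₂ : d x y ≡ 1F → P x y 1F 2F ≡ 54
  P₁₂ {x} {y} xy = b₁ {y} {x} (trans (d-sym y x) xy)

  flip₁ : d x y ≡ 1F → d y x ≡ 1F
  flip₁ {x} {y} = trans (d-sym y x)

  -- Both sides count the edges zw with z adjacent to x and w at distance 2 from y.
  P₂₂ : d x y ≡ 1F → P x y 2F 2F ≡ 558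
  P₂₂ {x} {y} xy = trans (P-sym x y 2F 2F) (counts {g = P y x 2F 2F} (P₁₁ xy) (P₁₂ xy) (P-far {i = 1F} {3F} xy (s≤s (s≤s (s≤s z≤n))))
    (trans (P-sym y x 2F 0F) (P-far {i = 0F} {2F} xy (s≤s (s≤s z≤n)))) (trans (P-sym y x 2F 1F) (P₁₂ xy))
    (begin
      P x y 1F 1F * 54 + (P x y 1F 2F * 62 + (P x y 1F 3F * 60 + 0))
        ≡⟨ sum-combination (δ 1F x) ((δ 1F y , 54) ∷ (δ 2F y , 62) ∷ (δ 3F y , 60) ∷ []) ⟨
      sum (λ z → ⟦ δ 1F x z ⟧ * combination ((δ 1F y , 54) ∷ (δ 2F y , 62) ∷ (δ 3F y , 60) ∷ []) z)
        ≡⟨ sum-cong-≗ (λ z → cong (⟦ δ 1F x z ⟧ *_) (#-neighbours₂ y z)) ⟨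
      sum (λ z → ⟦ δ 1F x z ⟧ * # (λ w → δ 1F z w ∧ δ 2F y w))
        ≡⟨ double-sum (δ 1F x) (δ 2F y) (δ 1F) ⟩
      sum (λ w → ⟦ δ 2F y w ⟧ * # (λ z → δ 1F z w ∧ δ 1F x z))
        ≡⟨ sum-cong-≗ (λ w → cong (⟦ δ 2F y w ⟧ *_) (trans (sum-cong-≗ λ z → cong (λ b → ⟦ b ∧ δ 1F x z ⟧) (δ-sym 1F z w)) (#-neighbours₁ x w))) ⟩
      sum (λ w → ⟦ δ 2F y w ⟧ * combination ((δ 0F x , 80) ∷ (δ 1F x , 25) ∷ (δ 2F x , 6) ∷ []) w)
        ≡⟨ sum-combination (δ 2F y) ((δ 0F x , 80) ∷ (δ 1F x , 25) ∷ (δ 2F x , 6) ∷ []) ⟩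
      P y x 2F 0F * 80 + (P y x 2F 1F * 25 + (P y x 2F 2F * 6 + 0)) ∎))
    where
    open ≡-Reasoning
    counts : ∀ {a b c e f g} → a ≡ 25 → b ≡ 54 → c ≡ 0 → e ≡ 0 → f ≡ 54 →
             a * 54 + (b * 62 + (c * 60 + 0)) ≡ e * 80 + (f * 25 + (g * 6 + 0)) → g ≡ 558
    counts {g = g} refl refl refl refl refl eq = *-cancelʳ-≡ g 558 6
      (trans (sym (+-identityʳ (g * 6))) (sym (+-cancelˡ-≡ 1350 3348 (g * 6 + 0) eq)))

  -- These row sums determine `P₂₃` once `P₂₂` is known, and then `P₃₃`.
  split : ∀ x y i → P x y i 0F + (P x y i 1F + (P x y i 2F + (P x y i 3F + 0))) ≡ valency i
  split x y i = trans (count-≡ ((λ p → exactly-one) ∷ [])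
    ((λ p a b c d → p ∧ a) ∷ (λ p a b c d → p ∧ b) ∷ (λ p a b c d → p ∧ c) ∷ (λ p a b c d → p ∧ d) ∷ []) ((λ p a b c d → p) ∷ [])
    (δ i x ∷ δ 0F y ∷ δ 1F y ∷ δ 2F y ∷ δ 3F y ∷ []) (λ w → one-class y w ∷ []) refl)
    (trans (+-identityʳ _) (#δ i x))

  P₂₃ : d x y ≡ 1F → P x y 2F 3F ≡ 108
  P₂₃ {x} {y} xy = counts {P x y 2F 3F} (trans (P-sym x y 2F 0F) (P-far {i = 0F} {2F} (flip₁ xy) (s≤s (s≤s z≤n))))
    (trans (P-sym x y 2F 1F) (P₁₂ (flip₁ xy))) (P₂₂ xy) (split x y 2F)
    where
    counts : ∀ {x a b c} → a ≡ 0 → b ≡ 54 → c ≡ 558 → a + (b + (c + (x + 0))) ≡ 720 → x ≡ 108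
    counts {x} refl refl refl eq = +-cancelˡ-≡ 612 x 108 (trans (cong (612 +_) (sym (+-identityʳ x))) eq)

  P₃₃ : d x y ≡ 1F → P x y 3F 3F ≡ 36
  P₃₃ {x} {y} xy = counts {P x y 3F 3F} (trans (P-sym x y 3F 0F) (P-far {i = 0F} {3F} (flip₁ xy) (s≤s (s≤s z≤n))))
    (trans (P-sym x y 3F 1F) (P-far {i = 1F} {3F} (flip₁ xy) (s≤s (s≤s (s≤s z≤n)))))
    (trans (P-sym x y 3F 2F) (P₂₃ (flip₁ xy))) (split x y 3F)
    where
    counts : ∀ {x a b c} → a ≡ 0 → b ≡ 0 → c ≡ 108 → a + (b + (c + (x + 0))) ≡ 144 → x ≡ 36
    counts {x} refl refl refl eq = +-cancelˡ-≡ 108 x 36 (trans (cong (108 +_) (sym (+-identityʳ x))) eq)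

  P≡p¹-upper : ∀ i j → toℕ i ≤ toℕ j → d x y ≡ 1F → P x y i j ≡ p¹ i j
  P≡p¹-upper 0F 0F _ xy = P₀₀ xy
  P≡p¹-upper {x} {y} 0F 1F _ xy = trans (P-sym x y 0F 1F) (P₁₀ (flip₁ xy))
  P≡p¹-upper 0F 2F _ xy = P-far {i = 0F} {2F} xy (s≤s (s≤s z≤n))
  P≡p¹-upper 0F 3F _ xy = P-far {i = 0F} {3F} xy (s≤s (s≤s z≤n))
  P≡p¹-upper 1F 1F _ xy = P₁₁ xy
  P≡p¹-upper 1F 2F _ xy = P₁₂ xy
  P≡p¹-upper 1F 3F _ xy = P-far {i = 1F} {3F} xy (s≤s (s≤s (s≤s z≤n)))
  P≡p¹-upper 2F 2F _ xy = P₂₂ xy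
  P≡p¹-upper 2F 3F _ xy = P₂₃ xy
  P≡p¹-upper 3F 3F _ xy = P₃₃ xy
  P≡p¹-upper (suc _) 0F () _
  P≡p¹-upper (suc (suc _)) 1F (s≤s ()) _
  P≡p¹-upper (suc (suc (suc _))) 2F (s≤s (s≤s ())) _

  p¹-sym : ∀ i j → p¹ i j ≡ p¹ j i
  p¹-sym = toWitness {a? = all? λ i → all? λ j → p¹ i j ≟ p¹ j i} _

  P≡p¹ : d x y ≡ 1F → ∀ i j → P x y i j ≡ p¹ i j
  P≡p¹ {x} {y} xy i j with ≤-total (toℕ i) (toℕ j)
  ... | inj₁ i≤j = P≡p¹-upper i j i≤j xy
  ... | inj₂ j≤i = trans (P-sym x y i j) (trans (P≡p¹-upper j i j≤i (flip₁ xy)) (p¹-sym j i))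

  module _ (F H : Fin 4 → ℕ) where

    expand : ∀ a b → F a * H b ≡ sum (λ i → sum (λ j → F i * H j * ⟦ does (a ≟ᶠ i) ∧ does (b ≟ᶠ j) ⟧))
    expand a b = sym (begin
      sum (λ i → sum (λ j → F i * H j * ⟦ does (a ≟ᶠ i) ∧ does (b ≟ᶠ j) ⟧))
        ≡⟨ sum-cong-≗ (λ i → sum-cong-≗ (λ j → shuffle (F i) (H j) (does (a ≟ᶠ i)) (does (b ≟ᶠ j)))) ⟩
      sum (λ i → sum (λ j → F i * ⟦ does (a ≟ᶠ i) ⟧ * H j * ⟦ does (b ≟ᶠ j) ⟧))
        ≡⟨ sum-cong-≗ (λ i → sum-delta (λ j → F i * ⟦ does (a ≟ᶠ i) ⟧ * H j) b) ⟩
      sum (λ i → F i * ⟦ does (a ≟ᶠ i) ⟧ * H b)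
        ≡⟨ *-distribʳ-sum (H b) (λ i → F i * ⟦ does (a ≟ᶠ i) ⟧) ⟨
      sum (λ i → F i * ⟦ does (a ≟ᶠ i) ⟧) * H b
        ≡⟨ cong (_* H b) (sum-delta F a) ⟩
      F a * H b ∎)
      where
      open ≡-Reasoning
      shuffle : ∀ k l p q → k * l * ⟦ p ∧ q ⟧ ≡ k * ⟦ p ⟧ * l * ⟦ q ⟧
      shuffle k l true  q = cong (λ t → t * l * ⟦ q ⟧) (sym (*-identityʳ k))
      shuffle k l false q rewrite *-zeroʳ k = *-zeroʳ (k * l)

    -- The vertices `w` are grouped by their pair of distances to `x` and `y`.
    correlation : ∀ x y → sum (λ w → F (d x w) * H (d y w)) ≡ sum (λ i → sum (λ j → F i * H j * P x y i j))
    correlation x y = begin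
      sum (λ w → F (d x w) * H (d y w))
        ≡⟨ sum-cong-≗ (λ w → expand (d x w) (d y w)) ⟩
      sum (λ w → sum (λ i → sum (λ j → F i * H j * ⟦ δ i x w ∧ δ j y w ⟧)))
        ≡⟨ ∑-comm (λ w i → sum (λ j → F i * H j * ⟦ δ i x w ∧ δ j y w ⟧)) ⟩
      sum (λ i → sum (λ w → sum (λ j → F i * H j * ⟦ δ i x w ∧ δ j y w ⟧)))
        ≡⟨ sum-cong-≗ (λ i → ∑-comm (λ w j → F i * H j * ⟦ δ i x w ∧ δ j y w ⟧)) ⟩
      sum (λ i → sum (λ j → sum (λ w → F i * H j * ⟦ δ i x w ∧ δ j y w ⟧)))
        ≡⟨ sum-cong-≗ (λ i → sum-cong-≗ (λ j → *-distribˡ-sum (F i * H j) (λ w → ⟦ δ i x w ∧ δ j y w ⟧))) ⟨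
      sum (λ i → sum (λ j → F i * H j * P x y i j)) ∎
      where open ≡-Reasoning

    correlation-adjacent : d x y ≡ 1F →
      sum (λ w → F (d x w) * H (d y w)) ≡ sum (λ i → sum (λ j → F i * H j * p¹ i j))
    correlation-adjacent {x} {y} xy = trans (correlation x y)
      (sum-cong-≗ λ i → sum-cong-≗ λ j → cong (F i * H j *_) (P≡p¹ xy i j))

    correlation-self : ∀ x → sum (λ w → F (d x w) * H (d x w)) ≡ sum (λ i → F i * H i * valency i)
    correlation-self x = begin
      sum (λ w → F (d x w) * H (d x w))                      ≡⟨ sum-cong-≗ (λ w → sum-delta (λ i → F i * H i) (d x w)) ⟨
      sum (λ w → sum (λ i → F i * H i * ⟦ δ i x w ⟧))        ≡⟨ ∑-comm (λ w i → F i * H i * ⟦ δ i x w ⟧) ⟩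
      sum (λ i → sum (λ w → F i * H i * ⟦ δ i x w ⟧))        ≡⟨ sum-cong-≗ (λ i → *-distribˡ-sum (F i * H i) (λ w → ⟦ δ i x w ⟧)) ⟨
      sum (λ i → F i * H i * # (δ i x))                      ≡⟨ sum-cong-≗ (λ i → cong (F i * H i *_) (#δ i x)) ⟩
      sum (λ i → F i * H i * valency i)                      ∎
      where open ≡-Reasoning

  -- Delsarte's clique bound

  -- The standard sequence of the eigenvalue -4 is (240, -12, 2, -5) up to scaling; φ⁺ and
  -- φ⁻ are its positive and negative parts.
  φ⁺ φ⁻ : Fin 4 → ℕ
  φ⁺ = Vec.lookup (240 ∷ 0 ∷ 2 ∷ 0 ∷ [])
  φ⁻ = Vec.lookup (0 ∷ 12 ∷ 0 ∷ 5 ∷ [])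

  2ab≤a²+b² : ∀ a b → a * b + a * b ≤ a * a + b * b
  2ab≤a²+b² zero    b       = z≤n
  2ab≤a²+b² (suc a) zero    rewrite *-zeroʳ a = z≤n
  2ab≤a²+b² (suc a) (suc b) = begin
    suc a * suc b + suc a * suc b           ≡⟨ lhs a b ⟩
    (a * b + a * b) + (2 + 2 * a + 2 * b)   ≤⟨ +-monoˡ-≤ (2 + 2 * a + 2 * b) (2ab≤a²+b² a b) ⟩
    (a * a + b * b) + (2 + 2 * a + 2 * b)   ≡⟨ rhs a b ⟨
    suc a * suc a + suc b * suc b           ∎
    where
    open ≤-Reasoning
    lhs : ∀ a b → suc a * suc b + suc a * suc b ≡ (a * b + a * b) + (2 + 2 * a + 2 * b)
    lhs = solve-∀
    rhs : ∀ a b → suc a * suc a + suc b * suc b ≡ (a * a + b * b) + (2 + 2 * a + 2 * b)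
    rhs = solve-∀

  module Delsarte {m : ℕ} (f : Fin m → Bool) (u : Fin m → V)
    (clique : ∀ i j → f i ≡ true → f j ≡ true → i ≢ j → d (u i) (u j) ≡ 1F) where

    -- For `φ⁺` minus `φ⁻` this would be, up to scaling, the projection of the characteristic vector
    -- of the clique to the eigenspace of -4. The two parts are kept apart to stay in the natural
    -- numbers.
    Φ : (Fin 4 → ℕ) → V → ℕ
    Φ F w = sum (λ i → ⟦ f i ⟧ * F (d (u i) w))

    Φ-product : ∀ F H → sum (λ w → Φ F w * Φ H w) ≡
      sum (λ i → sum (λ j → ⟦ f i ⟧ * ⟦ f j ⟧ * sum (λ w → F (d (u i) w) * H (d (u j) w))))
    Φ-product F H = begin
      sum (λ w → Φ F w * Φ H w)
        ≡⟨ sum-cong-≗ (λ w → trans (*-distribʳ-sum (Φ H w) (λ i → ⟦ f i ⟧ * F (d (u i) w)))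
             (sum-cong-≗ λ i → *-distribˡ-sum (⟦ f i ⟧ * F (d (u i) w)) (λ j → ⟦ f j ⟧ * H (d (u j) w)))) ⟩
      sum (λ w → sum (λ i → sum (λ j → ⟦ f i ⟧ * F (d (u i) w) * (⟦ f j ⟧ * H (d (u j) w)))))
        ≡⟨ ∑-comm (λ w i → sum (λ j → ⟦ f i ⟧ * F (d (u i) w) * (⟦ f j ⟧ * H (d (u j) w)))) ⟩
      sum (λ i → sum (λ w → sum (λ j → ⟦ f i ⟧ * F (d (u i) w) * (⟦ f j ⟧ * H (d (u j) w)))))
        ≡⟨ sum-cong-≗ (λ i → ∑-comm (λ w j → ⟦ f i ⟧ * F (d (u i) w) * (⟦ f j ⟧ * H (d (u j) w)))) ⟩
      sum (λ i → sum (λ j → sum (λ w → ⟦ f i ⟧ * F (d (u i) w) * (⟦ f j ⟧ * H (d (u j) w)))))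
        ≡⟨ sum-cong-≗ (λ i → sum-cong-≗ (λ j → trans
             (sum-cong-≗ λ w → [m*n]*[o*p]≡[m*o]*[n*p] ⟦ f i ⟧ (F (d (u i) w)) ⟦ f j ⟧ (H (d (u j) w)))
             (sym (*-distribˡ-sum (⟦ f i ⟧ * ⟦ f j ⟧) (λ w → F (d (u i) w) * H (d (u j) w)))))) ⟩
      sum (λ i → sum (λ j → ⟦ f i ⟧ * ⟦ f j ⟧ * sum (λ w → F (d (u i) w) * H (d (u j) w)))) ∎
      where open ≡-Reasoning

    Φ-gram : ∀ F H D O → sum (λ i → F i * H i * valency i) ≡ D → sum (λ i → sum (λ j → F i * H j * p¹ i j)) ≡ O →
             sum (λ w → Φ F w * Φ H w) + O * # f ≡ D * # f + O * (# f * # f)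
    Φ-gram F H D O D≡ O≡ = trans (cong (_+ O * # f) (Φ-product F H))
      (gram f (λ i j → sum (λ w → F (d (u i) w) * H (d (u j) w))) D O
        (λ i _ → trans (correlation-self F H (u i)) D≡)
        (λ i j fi fj i≢j → trans (correlation-adjacent F H (clique i j fi fj i≢j)) O≡))

    inner : (F H : Fin 4 → ℕ) → ℕ
    inner F H = sum (λ w → Φ F w * Φ H w)

    -- With s = `# f`, the squares of `Φ φ⁺ w` - `Φ φ⁻ w` sum to 75600 s - 3780 s (s - 1), where
    -- 75600 = 60480 + 15120 and -3780 = 2232 + 4500 - 2 · 5256. For positive s, nonnegativity gives
    -- s - 1 ≤ 20.
    #f≤21 : # f ≤ 21
    #f≤21 = counts (# f) {inner φ⁺ φ⁺} {inner φ⁻ φ⁻} {inner φ⁺ φ⁻} (Φ-gram φ⁺ φ⁺ 60480 2232 refl refl) (Φ-gram φ⁻ φ⁻ 15120 4500 refl refl)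
      (Φ-gram φ⁺ φ⁻ 0 5256 refl refl)
      (subst₂ _≤_ (∑-distrib-+ (λ w → Φ φ⁺ w * Φ φ⁻ w) (λ w → Φ φ⁺ w * Φ φ⁻ w))
                  (∑-distrib-+ (λ w → Φ φ⁺ w * Φ φ⁺ w) (λ w → Φ φ⁻ w * Φ φ⁻ w))
        (sum-mono-≤ _ _ λ w → 2ab≤a²+b² (Φ φ⁺ w) (Φ φ⁻ w)))
      where
      counts : ∀ s {A B C} → A + 2232 * s ≡ 60480 * s + 2232 * (s * s) → B + 4500 * s ≡ 15120 * s + 4500 * (s * s) →
               C + 5256 * s ≡ 0 * s + 5256 * (s * s) → C + C ≤ A + B → s ≤ 21
      counts zero _ _ _ _ = z≤n
      counts s@(suc _) {A} {B} {C} eqA eqB eqC C+C≤A+B =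
        *-cancelˡ-≤ 3780 (*-cancelʳ-≤ (3780 * s) (3780 * 21) s (+-cancelʳ-≤ K _ _ (begin
          3780 * s * s + K                               ≡⟨ lhs s ⟩
          (5256 * (s * s) + 5256 * (s * s)) + 6732 * s     ≡⟨ cong (λ t → t + t + 6732 * s) eqC ⟨
          (C + 5256 * s) + (C + 5256 * s) + 6732 * s       ≡⟨ mid C s ⟩
          (C + C) + (10512 * s + 6732 * s)                 ≤⟨ +-monoˡ-≤ (10512 * s + 6732 * s) C+C≤A+B ⟩
          (A + B) + (10512 * s + 6732 * s)                 ≡⟨ mid′ A B s ⟩
          (A + 2232 * s) + (B + 4500 * s) + 10512 * s      ≡⟨ cong₂ (λ t r → t + r + 10512 * s) eqA eqB ⟩
          (60480 * s + 2232 * (s * s)) + (15120 * s + 4500 * (s * s)) + 10512 * s ≡⟨ rhs s ⟩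
          3780 * 21 * s + K ∎)))
        where
        open ≤-Reasoning
        K : ℕ
        -- Added to both sides to balance the terms that would otherwise be subtracted.
        K = 6732 * (s * s) + 6732 * s
        lhs : ∀ s → 3780 * s * s + (6732 * (s * s) + 6732 * s) ≡ (5256 * (s * s) + 5256 * (s * s)) + 6732 * s
        lhs = solve-∀
        mid : ∀ C s → (C + 5256 * s) + (C + 5256 * s) + 6732 * s ≡ (C + C) + (10512 * s + 6732 * s)
        mid = solve-∀
        mid′ : ∀ A B s → (A + B) + (10512 * s + 6732 * s) ≡ (A + 2232 * s) + (B + 4500 * s) + 10512 * s
        mid′ = solve-∀
        rhs : ∀ s → (60480 * s + 2232 * (s * s)) + (15120 * s + 4500 * (s * s)) + 10512 * s ≡
              3780 * 21 * s + (6732 * (s * s) + 6732 * s)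
        rhs = solve-∀

-- From Γ to the local graph

lookup-injective : ∀ {A : Set} {xs : List A} → Unique xs → ∀ i j → List.lookup xs i ≡ List.lookup xs j → i ≡ j
lookup-injective (_ ∷ _)   zero    zero    _  = refl
lookup-injective (x∉ ∷ _)  zero    (suc j) eq = ⊥-elim (All.lookup x∉ (∈-lookup j) eq)
lookup-injective (x∉ ∷ _)  (suc i) zero    eq = ⊥-elim (All.lookup x∉ (∈-lookup i) (sym eq))
lookup-injective (_ ∷ uxs) (suc i) (suc j) eq = cong suc (lookup-injective uxs i j eq)

module _ {A : Set} where

  #-lookup-filter : ∀ {P : A → Set} (P? : Decidable P) (p : A → Bool) xs →
    # (p ∘ List.lookup (filter P? xs)) ≡ # (λ i → does (P? (List.lookup xs i)) ∧ p (List.lookup xs i))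
  #-lookup-filter P? p [] = refl
  #-lookup-filter P? p (x ∷ xs) with does (P? x)
  ... | true  = cong (⟦ p x ⟧ +_) (#-lookup-filter P? p xs)
  ... | false = #-lookup-filter P? p xs

  sum-lookup-tabulate : ∀ {n} (f : A → ℕ) (g : Fin n → A) → sum (f ∘ List.lookup (List.tabulate g)) ≡ sum (f ∘ g)
  sum-lookup-tabulate {zero}  f g = refl
  sum-lookup-tabulate {suc n} f g = cong (f (g zero) +_) (sum-lookup-tabulate f (g ∘ suc))

module LocalCount (Γ : Graph) (regular : IsDistanceRegular Γ (80 ∷ 54 ∷ 12 ∷ []) (1 ∷ 6 ∷ 60 ∷ [])) (x : Vertex Γ) where
  open Graph Γ using (adj?)
  open Intersection Γ regular

  vertices : List (Vertex Γ)
  vertices = filter (adj? x) (allFin (order Γ))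

  m : ℕ
  m = List.length vertices

  vertex : Fin m → Vertex Γ
  vertex = List.lookup vertices

  adj : Vertex Γ → Vertex Γ → Bool
  adj y z = does (adj? y z)

  adj≡δ : ∀ y z → adj y z ≡ δ 1F y z
  adj≡δ y z = bool-cong (λ yz → δ-true (Adj⇒d≡1 (does-true (adj? y z) yz)))
                        (λ yz → dec-true (adj? y z) (d≡1⇒Adj (δ⇒≡ yz)))

  #-local : (p : Vertex Γ → Bool) → # (p ∘ vertex) ≡ # (λ v → δ 1F x v ∧ p v)
  #-local p = trans (#-lookup-filter (adj? x) p (allFin (order Γ)))
    (trans (sum-lookup-tabulate (λ v → ⟦ adj x v ∧ p v ⟧) (λ v → v))
           (sum-cong-≗ λ v → cong (λ b → ⟦ b ∧ p v ⟧) (adj≡δ x v)))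

  vertex-adj : ∀ i → d x (vertex i) ≡ 1F
  vertex-adj i = Adj⇒d≡1 (proj₂ (∈-filter⁻ (adj? x) {xs = allFin (order Γ)} (∈-lookup i)))

  vertex-injective : ∀ {i j} → vertex i ≡ vertex j → i ≡ j
  vertex-injective {i} {j} = lookup-injective (filter⁺ (adj? x) (allFin⁺ (order Γ))) i j

  m≡80 : m ≡ 80
  m≡80 = trans (sym #-⊤) (trans (#-local (λ _ → true))
    (trans (sum-cong-≗ λ v → cong ⟦_⟧ (Bool.∧-identityʳ (δ 1F x v))) (degree x)))

  _~_ : Fin m → Fin m → Bool
  i ~ j = does (i ≟ᶠ j) ∨ δ 1F (vertex i) (vertex j)

  ~-sym : ∀ i j → i ~ j ≡ j ~ i
  ~-sym i j = cong₂ _∨_ (bool-cong (λ p → dec-true (j ≟ᶠ i) (sym (does-true (i ≟ᶠ j) p)))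
                                   (λ p → dec-true (i ≟ᶠ j) (sym (does-true (j ≟ᶠ i) p))))
                        (δ-sym 1F (vertex i) (vertex j))

  δ₁-irrefl : ∀ y → not (δ 1F y y) ≡ true
  δ₁-irrefl y rewrite d-refl y = refl

  -- The vertex itself and its a₁ = 25 neighbours that are also adjacent to `x`.
  degree-local : ∀ i → # (i ~_) ≡ 26
  degree-local i = trans (sum-cong-≗ split-self) (trans (∑-distrib-+ (λ j → ⟦ does (i ≟ᶠ j) ⟧) (λ j → ⟦ δ 1F (vertex i) (vertex j) ⟧))
    (cong₂ _+_ (trans (sum-cong-≗ λ j → sym (*-identityˡ ⟦ does (i ≟ᶠ j) ⟧)) (sum-delta (λ _ → 1) i))
               (trans (#-local (δ 1F (vertex i))) (trans (#-∧-comm (δ 1F x) (δ 1F (vertex i))) (a₁ {x} {vertex i} (vertex-adj i))))))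
    where
    split-self : ∀ j → ⟦ i ~ j ⟧ ≡ ⟦ does (i ≟ᶠ j) ⟧ + ⟦ δ 1F (vertex i) (vertex j) ⟧
    split-self j with i ≟ᶠ j
    ... | no _     = refl
    ... | yes refl with δ 1F (vertex i) (vertex i) | δ₁-irrefl (vertex i)
    ...   | false | _ = refl

  -- Two vertices of the local graph are joined by a path through `x`, which excludes distance 3.
  ≁⇒d≡2 : ∀ {i j} → not (i ~ j) ≡ true → d (vertex i) (vertex j) ≡ 2F
  ≁⇒d≡2 {i} {j} i≁j = go (d (vertex i) (vertex j)) refl
    where
    hs : List (Formula 2)
    hs = (λ p q → not (p ∨ q)) ∷ []
    go : ∀ k → d (vertex i) (vertex j) ≡ k → d (vertex i) (vertex j) ≡ 2F
    go 0F eq = contradictory (dec-true (i ≟ᶠ j) (vertex-injective (d≡0⇒≡ eq)))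
      (entails hs (λ p q → not p) refl (does (i ≟ᶠ j) ∷ δ 1F (vertex i) (vertex j) ∷ []) (i≁j ∷ []))
    go 1F eq = contradictory (δ-true eq)
      (entails hs (λ p q → not q) refl (does (i ≟ᶠ j) ∷ δ 1F (vertex i) (vertex j) ∷ []) (i≁j ∷ []))
    go 2F eq = eq
    go 3F eq = contradictory (δ-true eq) (too-far {vertex i} {x} {1F} {3F} {vertex j}
      (trans (d-sym (vertex i) x) (vertex-adj i)) (s≤s (s≤s (s≤s z≤n))) (vertex-adj j))

  -- One of the c₂ = 6 common neighbours in Γ is `x` itself, which lies outside the local graph.
  common-local : ∀ {i j} → not (i ~ j) ≡ true → # (λ k → i ~ k ∧ j ~ k) ≤ 5
  common-local {i} {j} i≁j = begin
    # (λ k → i ~ k ∧ j ~ k)                                                      ≤⟨ #-mono proper ⟩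
    # (λ k → δ 1F (vertex i) (vertex k) ∧ δ 1F (vertex j) (vertex k))            ≡⟨ #-local (λ v → δ 1F (vertex i) v ∧ δ 1F (vertex j) v) ⟩
    # (λ v → δ 1F x v ∧ (δ 1F (vertex i) v ∧ δ 1F (vertex j) v))                 ≤⟨ minus-x ⟩
    5                                                                            ∎
    where
    open ≤-Reasoning
    -- If `k` were `i` or `j`, then `i ~ j` would follow, so common closed neighbours are proper
    -- common neighbours.
    proper : ∀ k → i ~ k ∧ j ~ k ≡ true → δ 1F (vertex i) (vertex k) ∧ δ 1F (vertex j) (vertex k) ≡ true
    proper k p = entails
      ((λ ei ai ej aj → (ei ∨ ai) ∧ (ej ∨ aj)) ∷ (λ ei ai ej aj → ei ⇒ not (ej ∨ aj)) ∷ (λ ei ai ej aj → ej ⇒ not (ei ∨ ai)) ∷ [])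
      (λ ei ai ej aj → ai ∧ aj) refl
      (does (i ≟ᶠ k) ∷ δ 1F (vertex i) (vertex k) ∷ does (j ≟ᶠ k) ∷ δ 1F (vertex j) (vertex k) ∷ [])
      (p ∷ ⇒-intro (λ i≡k → subst (λ l → not (j ~ l) ≡ true) (does-true (i ≟ᶠ k) i≡k) (trans (cong not (~-sym j i)) i≁j)) ∷
           ⇒-intro (λ j≡k → subst (λ l → not (i ~ l) ≡ true) (does-true (j ≟ᶠ k) j≡k) i≁j) ∷ [])
    minus-x : # (λ v → δ 1F x v ∧ (δ 1F (vertex i) v ∧ δ 1F (vertex j) v)) ≤ 5
    minus-x = counts (#δ₀ x) (c₂ {vertex j} {vertex i} (trans (d-sym (vertex j) (vertex i)) (≁⇒d≡2 i≁j)))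
      (count-≤ ((λ o x i j → o ⇒ not x) ∷ (λ o x i j → o ⇒ i) ∷ (λ o x i j → o ⇒ j) ∷ [])
        ((λ o x i j → x ∧ (i ∧ j)) ∷ (λ o x i j → o) ∷ []) ((λ o x i j → i ∧ j) ∷ [])
        (δ 0F x ∷ δ 1F x ∷ δ 1F (vertex i) ∷ δ 1F (vertex j) ∷ [])
        (λ v → ⇒-intro (λ xv → subst (λ w → not (δ 1F x w) ≡ true) (d≡0⇒≡ (δ⇒≡ xv)) (δ₁-irrefl x)) ∷
               ⇒-intro (near i) ∷ ⇒-intro (near j) ∷ []) refl)
      where
      near : ∀ k {v} → δ 0F x v ≡ true → δ 1F (vertex k) v ≡ true
      near k xv = δ-true (subst (λ w → d (vertex k) w ≡ 1F) (d≡0⇒≡ (δ⇒≡ xv)) (trans (d-sym (vertex k) x) (vertex-adj k)))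
      counts : ∀ {a o c} → o ≡ 1 → c ≡ 6 → a + (o + 0) ≤ c + 0 → a ≤ 5
      counts {a} refl refl le = +-cancelʳ-≤ 1 a 5 le

  -- Adjoining `x` gives a clique of Γ with one more vertex, to which the bound 21 applies.
  clique-local : ∀ p → (∀ i j → p i ≡ true → p j ≡ true → i ~ j ≡ true) → # p ≤ 20
  clique-local p p-clique = +-cancelˡ-≤ 1 (# p) 20 (Delsarte.#f≤21 f u clique)
    where
    f : Fin (suc m) → Bool
    f zero    = true
    f (suc i) = p i
    u : Fin (suc m) → Vertex Γ
    u zero    = x
    u (suc i) = vertex i
    clique : ∀ i j → f i ≡ true → f j ≡ true → i ≢ j → d (u i) (u j) ≡ 1F
    clique zero    zero    _  _  i≢j = ⊥-elim (i≢j refl)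
    clique zero    (suc j) _  _  _   = vertex-adj j
    clique (suc i) zero    _  _  _   = trans (d-sym (vertex i) x) (vertex-adj i)
    clique (suc i) (suc j) pi pj i≢j = δ⇒≡ (entails ((λ p q → p ∨ q) ∷ (λ p q → not p) ∷ []) (λ p q → q) refl
      (does (i ≟ᶠ j) ∷ δ 1F (vertex i) (vertex j) ∷ [])
      (p-clique i j pi pj ∷ cong not (dec-false (i ≟ᶠ j) (i≢j ∘ cong suc)) ∷ []))

  open LocalStructure _~_ ~-sym m≡80 degree-local common-local clique-local public using (four-cliques)

∈-tabulate⁻ : ∀ {n} (p : Fin n → Bool) {v} → v ∈ Vec.tabulate p → p v ≡ true
∈-tabulate⁻ p {v} v∈ = trans (sym (lookup∘tabulate p v)) ([]=⇒lookup v∈)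

proposition5p5 : (Γ : Graph) →
    IsDistanceRegular Γ (80 ∷ 54 ∷ 12 ∷ []) (1 ∷ 6 ∷ 60 ∷ []) →
    (x : Vertex Γ) →
    ∃ λ (C : Fin 4 → Subset (order (localGraph Γ x))) →
    (∀ i → IsClique (localGraph Γ x) (C i) × ∣ C i ∣ ≡ 20) ×
    (∀ i j → i ≢ j → Empty (C i ∩ C j))
proposition5p5 Γ regular x =
  let C , cliques , disjoint = four-cliques in
  (λ i → Vec.tabulate (C i)) ,
  (λ i → (λ {u} {v} u∈ v∈ u≢v → local-adj u≢v (proj₁ (cliques i) u v (∈-tabulate⁻ (C i) u∈) (∈-tabulate⁻ (C i) v∈))) ,
         trans (∣S∣≡# (Vec.tabulate (C i))) (trans (sum-cong-≗ λ v → cong ⟦_⟧ (lookup∘tabulate (C i) v)) (proj₂ (cliques i)))) ,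
  (λ i j i≢j (v , v∈) → let v∈i , v∈j = x∈p∩q⁻ (Vec.tabulate (C i)) (Vec.tabulate (C j)) v∈ in
    disjoint i j i≢j v (∈-tabulate⁻ (C i) v∈i) (∈-tabulate⁻ (C j) v∈j))
  where
  open LocalCount Γ regular x
  open Intersection Γ regular using (δ; d≡1⇒Adj; δ⇒≡)
  local-adj : ∀ {u v} → u ≢ v → u ~ v ≡ true → Graph.Adj (localGraph Γ x) u v
  local-adj {u} {v} u≢v uv = d≡1⇒Adj (δ⇒≡ (entails ((λ p q → p ∨ q) ∷ (λ p q → not p) ∷ []) (λ p q → q) refl
    (does (u ≟ᶠ v) ∷ δ (suc zero) (vertex u) (vertex v) ∷ []) (uv ∷ cong not (dec-false (u ≟ᶠ v) u≢v) ∷ [])))
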